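{- There exists a function $f$ such that for every $\epsilon>0$, every graph $G$ with $\mathrm{mad}(G)<3-\epsilon$ and $\Delta(G)\geq f(\epsilon)$ satisfies $\chi^2_\ell(G)=\Delta(G)+1$. -}

module Defs where

open import Data.Bool using (Bool; true; false; if_then_else_; _∧_; T)
open import Data.Nat using (ℕ; zero; suc; _+_; _⊔_; _≤_; _<_)
open import Data.Fin using (Fin; zero; suc)
open import Data.List using (List; length)
open import Data.List.Membership.Propositional using (_∈_)
open import Data.List.Relation.Unary.Unique.Propositional using (Unique)
open import Data.Product using (Σ; ∃; _×_)
open import Data.Sum using (_⊎_)
open import Data.Integer using (+_)
open import Data.Rational using (ℚ; _/_)
import Data.Rational as ℚ
open import Relation.Binary.PropositionalEquality using (_≡_; _≢_)
open import Relation.Nullary using (¬_)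

record Graph (n : ℕ) : Set where
  field
    adj   : Fin n → Fin n → Bool
    sym   : ∀ u v → adj u v ≡ adj v u
    loopless : ∀ v → adj v v ≡ false
open Graph public

count : ∀ {n} → (Fin n → Bool) → ℕ
count {zero}  p = 0
count {suc n} p = (if p zero then 1 else 0) + count (λ i → p (suc i))

sumF : ∀ {n} → (Fin n → ℕ) → ℕ
sumF {zero}  f = 0
sumF {suc n} f = f zero + sumF (λ i → f (suc i))

maxF : ∀ {n} → (Fin n → ℕ) → ℕ
maxF {zero}  f = 0
maxF {suc n} f = f zero ⊔ maxF (λ i → f (suc i))

degree : ∀ {n} → Graph n → Fin n → ℕ
degree G v = count (adj G v)

-- maximum degree Δ(G) (0 for the empty graph)
Δ : ∀ {n} → Graph n → ℕ
Δ G = maxF (degree G)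

twiceEdges : ∀ {n} → Graph n → (Fin n → Bool) → ℕ
twiceEdges G S = sumF (λ u → count (λ v → S u ∧ (S v ∧ adj G u v)))

ℕtoℚ : ℕ → ℚ
ℕtoℚ k = + k / 1

-- mad(G) < b : every nonempty (induced) subgraph H has average degree
-- 2|E(H)|/|V(H)| < b.
madLT : ∀ {n} → Graph n → ℚ → Set
madLT G b = ∀ S → 0 < count S →
  ℚ._<_ (ℕtoℚ (twiceEdges G S)) (ℚ._*_ b (ℕtoℚ (count S)))

Dist≤2 : ∀ {n} → Graph n → Fin n → Fin n → Set
Dist≤2 G u v = T (adj G u v) ⊎ ∃ (λ w → T (adj G u w) × T (adj G w v))

Square-choosable : ∀ {n} → Graph n → ℕ → Set
Square-choosable {n} G k =
  (L : Fin n → List ℕ) →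
  (∀ v → Unique (L v) × k ≤ length (L v)) →
  Σ (Fin n → ℕ) (λ c → (∀ v → c v ∈ L v) ×
     (∀ u v → u ≢ v → Dist≤2 G u v → c u ≢ c v))

-- χ²_ℓ(G) = k  (least k for which G² is k-choosable; choosability is
-- monotone in k, so this is: k-choosable and not (k-1)-choosable)
χ²ℓ≡ : ∀ {n} → Graph n → ℕ → Set
χ²ℓ≡ G zero    = Square-choosable G 0
χ²ℓ≡ G (suc k) = Square-choosable G (suc k) × ¬ Square-choosable G k

{-# OPTIONS --safe #-}
module Submission where

-- The lower bound is the clique formed in the square by a vertex of maximum degree and its
-- neighbours. For the upper bound write ε ≥ 1/m, k = Δ, and call a vertex big if its degree is at
-- least M = 2m(m+3), where M² ≤ k; we induct on the number of edges. A vertex that is small and has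
-- only small neighbours sees at most M² ≤ k vertices in the square, so it can be coloured last.
-- Leaves, and links (2-vertices with small neighbours) next to a small vertex without big
-- neighbours, are therefore reducible. Let the tips be the small vertices with exactly one big
-- neighbour whose other neighbours are all links. Joining tips through links gives classes, and
-- discharging shows that there are more than m classes per big vertex that consist of at most m
-- vertices, all of them tips. An augmenting path argument then finds a nonempty set of such classes
-- together with a choice of heads, at most one per class, so that every big vertex next to one of
-- these classes is next to at least m heads. Uncolour these tips and the links between them: two
-- of the tips can conflict only if they have the same big neighbour or the same class, so this is a
-- list edge colouring problem of a bipartite multigraph (big vertices against classes). Ordering
-- the heads last around big vertices and first in their classes, Galvin's kernel method applies.

open import Defs renaming (sym to adj-sym)
open import Data.Bool using (Bool; true; if_then_else_; _∧_; not; T; T?)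
open import Data.Bool.Properties using (T-∧)
open import Data.Nat
open import Data.Nat.Properties
open import Data.Nat.Tactic.RingSolver using (solve-∀)
open import Algebra.Properties.CommutativeSemigroup +-commutativeSemigroup using (interchange)
open import Data.Fin using (Fin; zero; suc; toℕ; fromℕ<)
import Data.Fin.Properties as Fin
import Data.Integer as ℤ
import Data.Integer.Properties as ℤ
import Data.Integer.Tactic.RingSolver as ℤ-Solver
open import Data.Rational using (ℚ; mkℚ; 0ℚ; ↧ₙ_; toℚᵘ)
import Data.Rational as ℚ
import Data.Rational.Properties as ℚ
open import Data.Rational.Unnormalised using (mkℚᵘ; *<*)
import Data.Rational.Unnormalised as ℚᵘ
import Data.Rational.Unnormalised.Properties as ℚᵘ
open import Data.List using (List; []; _∷_; length; filter; upTo)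
open import Data.List.Properties using (filter-all; filter-accept; filter-reject; length-upTo)
open import Data.List.Membership.Propositional using (_∈_; _∉_)
open import Data.List.Membership.Propositional.Properties using (∈-filter⁻; ∈-upTo⁻)
open import Data.List.Membership.DecPropositional _≟_ using (_∈?_)
open import Data.List.Relation.Unary.Any using (here)
import Data.List.Relation.Unary.All as All
open import Data.List.Relation.Unary.AllPairs using (_∷_)
open import Data.List.Relation.Unary.Unique.Propositional using (Unique)
import Data.List.Relation.Unary.Unique.Propositional.Properties as Unique
open import Data.Product using (Σ; ∃; _×_; _,_; proj₁; proj₂)
open import Data.Sum using (_⊎_; inj₁; inj₂; [_,_]′)
open import Data.Empty using (⊥; ⊥-elim)
open import Data.Unit using (⊤; tt)
open import Function using (_∘_; id; Equivalence; mk⇔)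
open import Relation.Nullary using (¬_; Dec; yes; no; does; contradiction)
open import Relation.Nullary.Decidable using (_×-dec_; _⊎-dec_; _→-dec_; ¬?; decidable-stable; does-⇔)
open import Relation.Binary using (tri<; tri≈; tri>)
open import Relation.Binary.PropositionalEquality using (_≡_; _≢_; refl; sym; trans; cong; cong₂; subst; subst₂; module ≡-Reasoning)

-- Counting in finite sets

sumF-mono : ∀ {n} {f g : Fin n → ℕ} → (∀ x → f x ≤ g x) → sumF f ≤ sumF g
sumF-mono {zero}  h = z≤n
sumF-mono {suc n} h = +-mono-≤ (h zero) (sumF-mono (h ∘ suc))

sumF-cong : ∀ {n} {f g : Fin n → ℕ} → (∀ x → f x ≡ g x) → sumF f ≡ sumF g
sumF-cong {zero}  h = refl
sumF-cong {suc n} h = cong₂ _+_ (h zero) (sumF-cong (h ∘ suc))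

sumF-+ : ∀ {n} (f g : Fin n → ℕ) → sumF (λ x → f x + g x) ≡ sumF f + sumF g
sumF-+ {zero}  f g = refl
sumF-+ {suc n} f g = trans (cong (f zero + g zero +_) (sumF-+ (f ∘ suc) (g ∘ suc)))
                           (interchange (f zero) (g zero) _ _)

sumF-* : ∀ {n} c (f : Fin n → ℕ) → sumF (λ x → c * f x) ≡ c * sumF f
sumF-* {zero}  c f = sym (*-zeroʳ c)
sumF-* {suc n} c f = trans (cong (c * f zero +_) (sumF-* c (f ∘ suc))) (sym (*-distribˡ-+ c (f zero) _))

sumF-0 : ∀ n → sumF {n} (λ _ → 0) ≡ 0
sumF-0 zero    = refl
sumF-0 (suc n) = sumF-0 n

sumF-1 : ∀ n → sumF {n} (λ _ → 1) ≡ n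
sumF-1 zero    = refl
sumF-1 (suc n) = cong suc (sumF-1 n)

sumF-swap : ∀ {n k} (f : Fin n → Fin k → ℕ) → sumF (λ x → sumF (f x)) ≡ sumF (λ y → sumF (λ x → f x y))
sumF-swap {zero}  {k} f = sym (sumF-0 k)
sumF-swap {suc n} f = trans (cong (sumF (f zero) +_) (sumF-swap (f ∘ suc)))
                            (sym (sumF-+ (f zero) (λ y → sumF (λ x → f (suc x) y))))

term≤sumF : ∀ {n} (f : Fin n → ℕ) x → f x ≤ sumF f
term≤sumF f zero    = m≤m+n _ _
term≤sumF f (suc x) = ≤-trans (term≤sumF (f ∘ suc) x) (m≤n+m _ (f zero))

sumF-mono-< : ∀ {n} {f g : Fin n → ℕ} → (∀ x → f x ≤ g x) → ∀ x → f x < g x → sumF f < sumF g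
sumF-mono-< h zero    p = +-mono-<-≤ p (sumF-mono (h ∘ suc))
sumF-mono-< h (suc x) p = +-mono-≤-< (h zero) (sumF-mono-< (h ∘ suc) x p)

χ : {A : Set} → Dec A → ℕ
χ d = if does d then 1 else 0

χ-yes : {A : Set} (d : Dec A) → A → χ d ≡ 1
χ-yes (yes _) a = refl
χ-yes (no ¬a) a = contradiction a ¬a

χ-no : {A : Set} (d : Dec A) → ¬ A → χ d ≡ 0
χ-no (yes a) ¬a = contradiction a ¬a
χ-no (no _)  ¬a = refl

χ≤1 : {A : Set} (d : Dec A) → χ d ≤ 1
χ≤1 (yes _) = ≤-refl
χ≤1 (no _)  = z≤n

χ-mono : {A B : Set} (a : Dec A) (b : Dec B) → (A → B) → χ a ≤ χ b
χ-mono (yes a) b h = ≤-reflexive (sym (χ-yes b (h a)))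
χ-mono (no _)  b h = z≤n

χ-× : {A B : Set} (a : Dec A) (b : Dec B) → χ (a ×-dec b) ≡ χ a * χ b
χ-× (yes _) (yes _) = refl
χ-× (yes _) (no _)  = refl
χ-× (no _)  _       = refl

χ-* : {A : Set} (a : Dec A) {x y : ℕ} → (A → x ≡ y) → χ a * x ≡ y * χ a
χ-* (yes a) {x} h = trans (+-identityʳ x) (trans (h a) (sym (*-identityʳ _)))
χ-* (no _)  {y = y} h = sym (*-zeroʳ y)

# : ∀ {n} {P : Fin n → Set} → (∀ x → Dec (P x)) → ℕ
# P? = count (λ x → does (P? x))

#≡sumF : ∀ {n} {P : Fin n → Set} (P? : ∀ x → Dec (P x)) → # P? ≡ sumF (λ x → χ (P? x))
#≡sumF {zero}  P? = refl
#≡sumF {suc n} P? = cong (χ (P? zero) +_) (#≡sumF (λ x → P? (suc x)))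

module _ {n} {P Q : Fin n → Set} (P? : ∀ x → Dec (P x)) (Q? : ∀ x → Dec (Q x)) where

  #-mono : (∀ x → P x → Q x) → # P? ≤ # Q?
  #-mono h rewrite #≡sumF P? | #≡sumF Q? = sumF-mono λ x → χ-mono (P? x) (Q? x) (h x)

  #-cong : (∀ x → P x → Q x) → (∀ x → Q x → P x) → # P? ≡ # Q?
  #-cong f g rewrite #≡sumF P? | #≡sumF Q? =
    sumF-cong λ x → ≤-antisym (χ-mono (P? x) (Q? x) (f x)) (χ-mono (Q? x) (P? x) (g x))

  #-mono-< : (∀ x → P x → Q x) → ∀ x → ¬ P x → Q x → # P? < # Q?
  #-mono-< h x ¬p q rewrite #≡sumF P? | #≡sumF Q? =
    sumF-mono-< (λ y → χ-mono (P? y) (Q? y) (h y)) x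
      (≤-reflexive (trans (cong suc (χ-no (P? x) ¬p)) (sym (χ-yes (Q? x) q))))

module _ {n} {P Q R : Fin n → Set} (P? : ∀ x → Dec (P x)) (Q? : ∀ x → Dec (Q x)) (R? : ∀ x → Dec (R x)) where

  #-disjoint : (∀ x → P x → R x) → (∀ x → Q x → R x) → (∀ x → P x → Q x → ⊥) → # P? + # Q? ≤ # R?
  #-disjoint f g d rewrite #≡sumF P? | #≡sumF Q? | #≡sumF R? =
    ≤-trans (≤-reflexive (sym (sumF-+ (λ x → χ (P? x)) (λ x → χ (Q? x))))) (sumF-mono pt)
    where
    pt : ∀ x → χ (P? x) + χ (Q? x) ≤ χ (R? x)
    pt x with P? x | Q? x
    ... | yes p | yes q = ⊥-elim (d x p q)
    ... | yes p | no _  = ≤-reflexive (sym (χ-yes (R? x) (f x p)))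
    ... | no _  | yes q = ≤-reflexive (sym (χ-yes (R? x) (g x q)))
    ... | no _  | no _  = z≤n

  #-cover : (∀ x → R x → P x ⊎ Q x) → # R? ≤ # P? + # Q?
  #-cover h rewrite #≡sumF P? | #≡sumF Q? | #≡sumF R? =
    ≤-trans (sumF-mono pt) (≤-reflexive (sumF-+ (λ x → χ (P? x)) (λ x → χ (Q? x))))
    where
    pt : ∀ x → χ (R? x) ≤ χ (P? x) + χ (Q? x)
    pt x with R? x
    ... | no _ = z≤n
    ... | yes r with h x r
    ...   | inj₁ p = ≤-trans (≤-reflexive (sym (χ-yes (P? x) p))) (m≤m+n _ _)
    ...   | inj₂ q = ≤-trans (≤-reflexive (sym (χ-yes (Q? x) q))) (m≤n+m _ (χ (P? x)))

#-none : ∀ {n} {P : Fin n → Set} (P? : ∀ x → Dec (P x)) → (∀ x → ¬ P x) → # P? ≡ 0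
#-none {n} P? h = trans (#≡sumF P?) (trans (sumF-cong λ x → χ-no (P? x) (h x)) (sumF-0 n))

#-all : ∀ {n} {P : Fin n → Set} (P? : ∀ x → Dec (P x)) → (∀ x → P x) → # P? ≡ n
#-all {n} P? h = trans (#≡sumF P?) (trans (sumF-cong λ x → χ-yes (P? x) (h x)) (sumF-1 n))

#≤n : ∀ {n} {P : Fin n → Set} (P? : ∀ x → Dec (P x)) → # P? ≤ n
#≤n {n} P? = ≤-trans (≤-reflexive (#≡sumF P?)) (≤-trans (sumF-mono λ x → χ≤1 (P? x)) (≤-reflexive (sumF-1 n)))

#-≡ : ∀ {n} (x : Fin n) → # (x Fin.≟_) ≡ 1
#-≡ {suc n} zero = cong suc (#-none {n} (λ y → zero Fin.≟ suc y) λ _ ())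
#-≡ (suc x) = trans (#-cong (λ y → suc x Fin.≟ suc y) (x Fin.≟_) (λ _ → Fin.suc-injective) (λ _ → cong suc)) (#-≡ x)

module _ {n} {P : Fin n → Set} (P? : ∀ x → Dec (P x)) where

  #-pos : ∀ x → P x → 0 < # P?
  #-pos x p = ≤-trans (≤-reflexive (sym (#-≡ x))) (#-mono (x Fin.≟_) P? λ { _ refl → p })

  #-witness : 0 < # P? → ∃ P
  #-witness pos with Fin.any? P?
  ... | yes w = w
  ... | no ¬w = contradiction (#-none P? λ x p → ¬w (x , p)) (>⇒≢ pos)

  others? : ∀ x y → Dec (P y × x ≢ y)
  others? x y = P? y ×-dec ¬? (x Fin.≟ y)

  #-remove : ∀ x → P x → suc (# (others? x)) ≤ # P?
  #-remove x p = subst (λ s → s + # (others? x) ≤ # P?) (#-≡ x)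
    (#-disjoint (x Fin.≟_) (others? x) P? (λ { _ refl → p }) (λ _ → proj₁) (λ _ e q → proj₂ q e))

  #≤1-unique : # P? ≤ 1 → ∀ x y → P x → P y → x ≡ y
  #≤1-unique le x y p q with x Fin.≟ y
  ... | yes e = e
  ... | no ne = contradiction le (<⇒≱ (≤-trans (s≤s others-pos) (#-remove x p)))
    where
    others-pos : 0 < # (others? x)
    others-pos = ≤-trans (≤-reflexive (sym (#-≡ y))) (#-mono (y Fin.≟_) (others? x) λ { _ refl → q , ne })

#-two : ∀ {n} {P : Fin n → Set} (P? : ∀ x → Dec (P x)) → # P? ≡ 2 →
        ∃ λ x → ∃ λ y → ∀ z → P z → z ≡ x ⊎ z ≡ y
#-two P? e with #-witness P? (subst (0 <_) (sym e) (s≤s z≤n))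
... | x , p with Fin.any? (others? P? x)
-- A missing second element needs no contradiction with the count: the pair `x`, `x` already covers
-- all of `P`.
...   | no ¬q = x , x , λ z r → inj₁ (decidable-stable (z Fin.≟ x) λ ne → ¬q (z , r , ne ∘ sym))
...   | yes (y , q) = x , y , λ z r → h z r
  where
  h : ∀ z → _ → z ≡ x ⊎ z ≡ y
  h z r with x Fin.≟ z
  ... | yes x≡z = inj₁ (sym x≡z)
  ... | no  x≢z = inj₂ (#≤1-unique (others? P? x)
                    (≤-pred (≤-trans (#-remove P? x p) (≤-reflexive e))) z y (r , x≢z) q)

#-fibres : ∀ {n k} {P : Fin n → Set} (P? : ∀ x → Dec (P x)) (f : Fin n → Fin k) →
           sumF (λ y → # (λ x → P? x ×-dec (f x Fin.≟ y))) ≡ # P?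
#-fibres {n} P? f = begin
  sumF (λ y → # (λ x → P? x ×-dec (f x Fin.≟ y)))          ≡⟨ sumF-cong (λ y → #≡sumF (λ x → P? x ×-dec (f x Fin.≟ y))) ⟩
  sumF (λ y → sumF (λ x → χ (P? x ×-dec (f x Fin.≟ y))))   ≡⟨ sumF-swap (λ y x → χ (P? x ×-dec (f x Fin.≟ y))) ⟩
  sumF (λ x → sumF (λ y → χ (P? x ×-dec (f x Fin.≟ y))))   ≡⟨ sumF-cong (λ x → sumF-cong λ y → χ-× (P? x) (f x Fin.≟ y)) ⟩
  sumF (λ x → sumF (λ y → χ (P? x) * χ (f x Fin.≟ y)))     ≡⟨ sumF-cong (λ x → sumF-* (χ (P? x)) (λ y → χ (f x Fin.≟ y))) ⟩
  sumF (λ x → χ (P? x) * sumF (λ y → χ (f x Fin.≟ y)))     ≡⟨ sumF-cong (λ x → cong (χ (P? x) *_) (trans (sym (#≡sumF (f x Fin.≟_))) (#-≡ (f x)))) ⟩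
  sumF (λ x → χ (P? x) * 1)                                ≡⟨ sumF-cong (λ x → *-identityʳ (χ (P? x))) ⟩
  sumF (λ x → χ (P? x))                                    ≡⟨ #≡sumF P? ⟨
  # P? ∎
  where open ≡-Reasoning

#-injection : ∀ {n k} {P : Fin n → Set} {Q : Fin k → Set} (P? : ∀ x → Dec (P x)) (Q? : ∀ x → Dec (Q x))
  (f : Fin n → Fin k) → (∀ x → P x → Q (f x)) → (∀ x y → P x → P y → f x ≡ f y → x ≡ y) → # P? ≤ # Q?
#-injection P? Q? f to inj = begin
  # P?                                               ≡⟨ #-fibres P? f ⟨
  sumF (λ y → # (λ x → P? x ×-dec (f x Fin.≟ y)))    ≤⟨ sumF-mono pt ⟩
  sumF (λ y → χ (Q? y))                              ≡⟨ #≡sumF Q? ⟨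
  # Q? ∎
  where
  open ≤-Reasoning
  -- Injectivity leaves at most one element in each fibre, and a nonempty fibre lies over a point of
  -- `Q`.
  pt : ∀ y → # (λ x → P? x ×-dec (f x Fin.≟ y)) ≤ χ (Q? y)
  pt y with Fin.any? (λ x → P? x ×-dec (f x Fin.≟ y))
  ... | no ¬w = ≤-trans (≤-reflexive (#-none (λ x → P? x ×-dec (f x Fin.≟ y)) λ x w → ¬w (x , w))) z≤n
  ... | yes (x , p , refl) = begin
    # (λ z → P? z ×-dec (f z Fin.≟ f x))  ≤⟨ #-mono (λ z → P? z ×-dec (f z Fin.≟ f x)) (x Fin.≟_) (λ z w → sym (inj z x (proj₁ w) p (proj₂ w))) ⟩
    # (x Fin.≟_)                          ≡⟨ #-≡ x ⟩
    1                                     ≡⟨ χ-yes (Q? (f x)) (to x p) ⟨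
    χ (Q? (f x)) ∎

#-∃ : ∀ {n k} {R : Fin n → Fin k → Set} (R? : ∀ x y → Dec (R x y)) →
      # (λ y → Fin.any? (λ x → R? x y)) ≤ sumF (λ x → # (R? x))
#-∃ R? = begin
  # (λ y → Fin.any? (λ x → R? x y))                  ≡⟨ #≡sumF (λ y → Fin.any? (λ x → R? x y)) ⟩
  sumF (λ y → χ (Fin.any? (λ x → R? x y)))           ≤⟨ sumF-mono pt ⟩
  sumF (λ y → sumF (λ x → χ (R? x y)))               ≡⟨ sumF-swap (λ y x → χ (R? x y)) ⟩
  sumF (λ x → sumF (λ y → χ (R? x y)))               ≡⟨ sumF-cong (λ x → #≡sumF (R? x)) ⟨
  sumF (λ x → # (R? x)) ∎
  where
  open ≤-Reasoning
  pt : ∀ y → χ (Fin.any? (λ x → R? x y)) ≤ sumF (λ x → χ (R? x y))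
  pt y with Fin.any? (λ x → R? x y)
  ... | no _ = z≤n
  ... | yes (x , r) = ≤-trans (≤-reflexive (sym (χ-yes (R? x y) r))) (term≤sumF (λ x → χ (R? x y)) x)

-- Galvin's theorem

delete : ℕ → List ℕ → List ℕ
delete a = filter (λ z → ¬? (a ≟ z))

length-delete-∉ : ∀ a L → a ∉ L → length (delete a L) ≡ length L
length-delete-∉ a L a∉ = cong length (filter-all (λ z → ¬? (a ≟ z)) (All.tabulate λ { z∈ refl → a∉ z∈ }))

length-delete : ∀ a L → Unique L → length L ≤ suc (length (delete a L))
length-delete a []      u = z≤n
length-delete a (z ∷ L) (z∉ ∷ u) with a ≟ z
... | yes refl rewrite filter-reject (λ z → ¬? (a ≟ z)) {a} {L} (λ ne → ne refl) =
  s≤s (≤-reflexive (sym (length-delete-∉ a L λ a∈ → All.lookup z∉ a∈ refl)))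
... | no ne rewrite filter-accept (λ z → ¬? (a ≟ z)) {z} {L} ne = s≤s (length-delete a L u)

-- The colours used on `P` are deleted one after another; the list has no repetitions, so each
-- deletion costs at most one entry.
avoid : ∀ {n} {P : Fin n → Set} (P? : ∀ x → Dec (P x)) (c : Fin n → ℕ) L → Unique L →
  ∃ λ L′ → Unique L′ × (∀ z → z ∈ L′ → z ∈ L × (∀ x → P x → c x ≢ z)) × length L ≤ # P? + length L′
avoid {zero}  P? c L u = L , u , (λ z z∈ → z∈ , λ ()) , ≤-refl
avoid {suc n} P? c L u with avoid (P? ∘ suc) (c ∘ suc) L u
... | L′ , u′ , ok , len with P? zero
...   | no ¬p = L′ , u′ , (λ z z∈ → proj₁ (ok z z∈) , λ { zero p → contradiction p ¬p ; (suc x) → proj₂ (ok z z∈) x }) , len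
...   | yes p = delete (c zero) L′ , Unique.filter⁺ _ u′ , ok′ , len′
  where
  ok′ : ∀ z → z ∈ delete (c zero) L′ → _
  ok′ z z∈ with ∈-filter⁻ (λ z → ¬? (c zero ≟ z)) {xs = L′} z∈
  ... | z∈′ , ne = proj₁ (ok z z∈′) , λ { zero _ → ne ; (suc x) → proj₂ (ok z z∈′) x }
  len′ : length L ≤ suc (# (P? ∘ suc) + length (delete (c zero) L′))
  len′ = ≤-trans len (≤-trans (+-monoʳ-≤ (# (P? ∘ suc)) (length-delete (c zero) L′ u′)) (≤-reflexive (+-suc _ _)))

nonempty-∈ : (L : List ℕ) → 0 < length L → ∃ (_∈ L)
nonempty-∈ (z ∷ L) _ = z , here refl

-- The elements of `Fin n` are the edges of a bipartite multigraph, with ends `p x` and `q x` on the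
-- two sides. Injectivity makes `ρ` and `σ` linear orders on the edges at each end.
module ListColouring {n} (p q : Fin n → Fin n) (ρ σ : Fin n → ℕ)
  (ρ-inj : ∀ x y → ρ x ≡ ρ y → x ≡ y) (σ-inj : ∀ x y → σ x ≡ σ y → x ≡ y) where

  -- x → y in the orientation of the line graph: y precedes x at a common end
  _≺₁_ _≺₂_ : Fin n → Fin n → Set
  y ≺₁ x = p y ≡ p x × ρ y < ρ x
  y ≺₂ x = q y ≡ q x × σ y < σ x

  _≺₁?_ : ∀ y x → Dec (y ≺₁ x)
  y ≺₁? x = (p y Fin.≟ p x) ×-dec (ρ y <? ρ x)

  _≺₂?_ : ∀ y x → Dec (y ≺₂ x)
  y ≺₂? x = (q y Fin.≟ q x) ×-dec (σ y <? σ x)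

  Meet : Fin n → Fin n → Set
  Meet x y = p x ≡ p y ⊎ q x ≡ q y

  record Kernel (U : Fin n → Set) : Set₁ where
    field
      K     : Fin n → Set
      K?    : ∀ x → Dec (K x)
      K⊆U   : ∀ {x} → K x → U x
      indep : ∀ {x y} → K x → K y → Meet x y → x ≡ y
      absorb : ∀ {x} → U x → ¬ K x → ∃ λ y → K y × (y ≺₁ x ⊎ y ≺₂ x)

  -- Stable matchings exist: if the p-minimal elements are not already a kernel,
  -- two of them meet in q, and the q-larger one may be left out, since whatever
  -- absorbs (or equals) the smaller one also absorbs the larger one.
  kernel : ∀ fuel {U : Fin n → Set} (U? : ∀ x → Dec (U x)) → # U? ≤ fuel → Kernel U
  kernel fuel {U} U? le = go (Fin.any? λ x → Fin.any? λ y → clash? x y)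
    where
    Minimal : Fin n → Set
    Minimal x = U x × ¬ (∃ λ y → U y × y ≺₁ x)
    minimal? : ∀ x → Dec (Minimal x)
    minimal? x = U? x ×-dec ¬? (Fin.any? λ y → U? y ×-dec (y ≺₁? x))
    Clash : Fin n → Fin n → Set
    Clash x y = Minimal x × Minimal y × x ≺₂ y
    clash? : ∀ x y → Dec (Clash x y)
    clash? x y = minimal? x ×-dec minimal? y ×-dec (x ≺₂? y)

    -- Descent in `ρ`; the bound `r` makes it terminate.
    below : ∀ r x → ρ x < r → U x → ∃ λ y → Minimal y × (y ≡ x ⊎ y ≺₁ x)
    below (suc r) x lt u with Fin.any? (λ y → U? y ×-dec (y ≺₁? x))
    ... | no ¬w = x , (u , ¬w) , inj₁ refl
    ... | yes (y , v , e , l) with below r y (≤-trans l (≤-pred lt)) v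
    ...   | z , mz , inj₁ refl     = z , mz , inj₂ (e , l)
    ...   | z , mz , inj₂ (e′ , l′) = z , mz , inj₂ (trans e′ e , <-trans l′ l)

    go : Dec (∃ λ x → ∃ λ y → Clash x y) → Kernel U
    go (no ¬c) = record
      { K = Minimal ; K? = minimal? ; K⊆U = proj₁
      ; indep = λ {x} {y} → ind x y
      ; absorb = λ {x} u ¬m → abs x u ¬m }
      where
      ind : ∀ x y → Minimal x → Minimal y → Meet x y → x ≡ y
      ind x y mx my (inj₁ e) with <-cmp (ρ x) (ρ y)
      ... | tri< l _ _ = ⊥-elim (proj₂ my (x , proj₁ mx , e , l))
      ... | tri≈ _ r _ = ρ-inj x y r
      ... | tri> _ _ l = ⊥-elim (proj₂ mx (y , proj₁ my , sym e , l))
      ind x y mx my (inj₂ e) with <-cmp (σ x) (σ y)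
      ... | tri< l _ _ = ⊥-elim (¬c (x , y , mx , my , e , l))
      ... | tri≈ _ r _ = σ-inj x y r
      ... | tri> _ _ l = ⊥-elim (¬c (y , x , my , mx , sym e , l))
      abs : ∀ x → U x → ¬ Minimal x → ∃ λ y → Minimal y × (y ≺₁ x ⊎ y ≺₂ x)
      abs x u ¬m with below (suc (ρ x)) x ≤-refl u
      ... | y , my , inj₁ refl = contradiction my ¬m
      ... | y , my , inj₂ l    = y , my , inj₁ l
    go (yes (x , y , mx , my , x≺y)) = extend fuel le
      where
      extend : ∀ fuel → # U? ≤ fuel → Kernel U
      extend zero le = contradiction (≤-trans (#-pos U? x (proj₁ mx)) le) λ ()
      extend (suc fuel) le = record
        { K = K ; K? = K? ; K⊆U = proj₁ ∘ K⊆U ; indep = indep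
        ; absorb = λ {z} u ¬k → abs z u ¬k }
        where
        open Kernel (kernel fuel (others? U? y) (≤-pred (≤-trans (#-remove U? y (proj₁ my)) le)))
        x≢y : y ≢ x
        x≢y refl = <-irrefl refl (proj₂ x≺y)
        abs : ∀ z → U z → ¬ K z → ∃ λ w → K w × (w ≺₁ z ⊎ w ≺₂ z)
        abs z u ¬k with y Fin.≟ z
        ... | no ne = absorb (u , ne) ¬k
        ... | yes refl with K? x
        ...   | yes kx = x , kx , inj₂ x≺y
        ...   | no ¬kx with absorb (proj₁ mx , x≢y) ¬kx
        ...     | w , kw , inj₁ l = ⊥-elim (proj₂ mx (w , proj₁ (K⊆U kw) , l))
        ...     | w , kw , inj₂ (e , l) = w , kw , inj₂ (trans e (proj₁ x≺y) , <-trans l (proj₂ x≺y))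

  -- The outdegree of `x` within `U`. A parallel edge that precedes `x` at both ends counts twice.
  earlier : {U : Fin n → Set} (U? : ∀ x → Dec (U x)) → Fin n → ℕ
  earlier U? x = # (λ y → U? y ×-dec (y ≺₁? x)) + # (λ y → U? y ×-dec (y ≺₂? x))

  -- Galvin's argument: colour a kernel of the set of vertices admitting a given colour.
  galvin : ∀ fuel {U : Fin n → Set} (U? : ∀ x → Dec (U x)) (L : Fin n → List ℕ) → # U? ≤ fuel →
    (∀ x → U x → Unique (L x) × earlier U? x < length (L x)) →
    ∃ λ (c : Fin n → ℕ) → (∀ x → U x → c x ∈ L x) × (∀ x y → U x → U y → x ≢ y → Meet x y → c x ≢ c y)
  galvin fuel {U} U? L le ok with Fin.any? U?
  galvin fuel {U} U? L le ok | no ¬u = (λ _ → 0) , (λ x u → ⊥-elim (¬u (x , u))) , λ x y u → ⊥-elim (¬u (x , u))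
  galvin zero {U} U? L le ok | yes (x₀ , u₀) = contradiction (≤-trans (#-pos U? x₀ u₀) le) λ ()
  galvin (suc fuel) {U} U? L le ok | yes (x₀ , u₀)
    with nonempty-∈ (L x₀) (≤-trans (s≤s z≤n) (proj₂ (ok x₀ u₀)))
  ... | a , a∈ = c , c∈ , proper
    where
    A? : ∀ x → Dec (U x × a ∈ L x)
    A? x = U? x ×-dec (a ∈? L x)
    open Kernel (kernel (# A?) A? ≤-refl)
    V : Fin n → Set
    V x = U x × ¬ K x
    V? : ∀ x → Dec (V x)
    V? x = U? x ×-dec ¬? (K? x)
    -- The kernel is nonempty because `a` lies in the list of `x₀`, so fewer vertices remain for the
    -- recursion.
    someK : ∃ K
    someK with K? x₀
    ... | yes k = x₀ , k
    ... | no ¬k = let y , k , _ = absorb (u₀ , a∈) ¬k in y , k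
    V<U : # V? < # U?
    V<U = #-mono-< V? U? (λ _ → proj₁) (proj₁ someK) (λ v → proj₂ v (proj₂ someK)) (proj₁ (K⊆U (proj₂ someK)))

    e₁ e₂ e₁′ e₂′ : Fin n → ℕ
    e₁ x = # (λ y → U? y ×-dec (y ≺₁? x))
    e₂ x = # (λ y → U? y ×-dec (y ≺₂? x))
    e₁′ x = # (λ y → V? y ×-dec (y ≺₁? x))
    e₂′ x = # (λ y → V? y ×-dec (y ≺₂? x))
    e₁≤ : ∀ x → e₁′ x ≤ e₁ x
    e₁≤ x = #-mono (λ y → V? y ×-dec (y ≺₁? x)) (λ y → U? y ×-dec (y ≺₁? x)) λ y → λ { ((u , _) , l) → u , l }
    e₂≤ : ∀ x → e₂′ x ≤ e₂ x
    e₂≤ x = #-mono (λ y → V? y ×-dec (y ≺₂? x)) (λ y → U? y ×-dec (y ≺₂? x)) λ y → λ { ((u , _) , l) → u , l }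
    e₁< : ∀ x y → K y → y ≺₁ x → e₁′ x < e₁ x
    e₁< x y k l = #-mono-< (λ y → V? y ×-dec (y ≺₁? x)) (λ y → U? y ×-dec (y ≺₁? x))
      (λ y → λ { ((u , _) , l) → u , l }) y (λ v → proj₂ (proj₁ v) k) (proj₁ (K⊆U k) , l)
    e₂< : ∀ x y → K y → y ≺₂ x → e₂′ x < e₂ x
    e₂< x y k l = #-mono-< (λ y → V? y ×-dec (y ≺₂? x)) (λ y → U? y ×-dec (y ≺₂? x))
      (λ y → λ { ((u , _) , l) → u , l }) y (λ v → proj₂ (proj₁ v) k) (proj₁ (K⊆U k) , l)

    room : ∀ x → V x → Unique (delete a (L x)) × earlier V? x < length (delete a (L x))
    room x (u , ¬k) = Unique.filter⁺ _ (proj₁ (ok x u)) , len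
      where
      len : e₁′ x + e₂′ x < length (delete a (L x))
      len with a ∈? L x
      ... | no a∉ = ≤-trans (s≤s (+-mono-≤ (e₁≤ x) (e₂≤ x)))
                      (≤-trans (proj₂ (ok x u)) (≤-reflexive (sym (length-delete-∉ a (L x) a∉))))
      -- The list of `x` loses the colour `a`, but an out-neighbour of `x` in the kernel is coloured
      -- and leaves the count too.
      ... | yes a∈x = ≤-trans shrink (≤-pred (≤-trans (proj₂ (ok x u)) (length-delete a (L x) (proj₁ (ok x u)))))
        where
        shrink : e₁′ x + e₂′ x < e₁ x + e₂ x
        shrink with absorb (u , a∈x) ¬k
        ... | y , k , inj₁ l = +-mono-<-≤ (e₁< x y k l) (e₂≤ x)
        ... | y , k , inj₂ l = +-mono-≤-< (e₁≤ x) (e₂< x y k l)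

    rest = galvin fuel V? (λ x → delete a (L x)) (≤-pred (≤-trans V<U le)) room
    c′ = proj₁ rest
    c′∈ : ∀ x → V x → c′ x ∈ L x × a ≢ c′ x
    c′∈ x v = ∈-filter⁻ (λ z → ¬? (a ≟ z)) {xs = L x} (proj₁ (proj₂ rest) x v)

    c : Fin n → ℕ
    c x with K? x
    ... | yes _ = a
    ... | no _  = c′ x
    c∈ : ∀ x → U x → c x ∈ L x
    c∈ x u with K? x
    ... | yes k = proj₂ (K⊆U k)
    ... | no ¬k = proj₁ (c′∈ x (u , ¬k))
    proper : ∀ x y → U x → U y → x ≢ y → Meet x y → c x ≢ c y
    proper x y u v ne m with K? x | K? y
    ... | yes k | yes l = λ _ → ne (indep k l m)
    ... | yes k | no ¬l = proj₂ (c′∈ y (v , ¬l))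
    ... | no ¬k | yes l = proj₂ (c′∈ x (u , ¬k)) ∘ sym
    ... | no ¬k | no ¬l = proj₂ (proj₂ rest) x y (u , ¬k) (v , ¬l) ne m

-- Classes and heads

update : ∀ {n} {A : Set} → (Fin n → A) → Fin n → A → Fin n → A
update f x a y with y Fin.≟ x
... | yes _ = a
... | no _  = f y

update-same : ∀ {n} {A : Set} (f : Fin n → A) x a → update f x a x ≡ a
update-same f x a with x Fin.≟ x
... | yes _ = refl
... | no ne = contradiction refl ne

update-other : ∀ {n} {A : Set} (f : Fin n → A) x a {y} → y ≢ x → update f x a y ≡ f y
update-other f x a {y} ne with y Fin.≟ x
... | yes e = contradiction e ne
... | no _  = refl

-- Union-find: merging the classes of the ends of an edge destroys at most one representative.
components : ∀ {r n} {P : Fin r → Set} (P? : ∀ e → Dec (P e)) (f g : Fin r → Fin n) →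
  ∃ λ (cls : Fin n → Fin n) → (∀ e → P e → cls (f e) ≡ cls (g e)) × n ≤ # (λ x → cls x Fin.≟ x) + # P?
components {zero} {n} P? f g = id , (λ ()) ,
  ≤-trans (≤-reflexive (sym (#-all (λ x → x Fin.≟ x) λ _ → refl))) (m≤m+n _ 0)
components {suc r} {n} P? f g with components (P? ∘ suc) (f ∘ suc) (g ∘ suc)
... | cls , same , le with P? zero
...   | no ¬p = cls , (λ { zero p → contradiction p ¬p ; (suc e) → same e }) , le
...   | yes p = merged , same′ , le′
  where
  a = cls (f zero)
  b = cls (g zero)
  merged : Fin n → Fin n
  merged x with cls x Fin.≟ a
  ... | yes _ = b
  ... | no _  = cls x
  merged-cong : ∀ x y → cls x ≡ cls y → merged x ≡ merged y
  merged-cong x y e with cls x Fin.≟ a | cls y Fin.≟ a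
  ... | yes _  | yes _  = refl
  ... | no _   | no _   = e
  ... | yes e₁ | no ne  = contradiction (trans (sym e) e₁) ne
  ... | no ne  | yes e₁ = contradiction (trans e e₁) ne
  merged-a : ∀ x → cls x ≡ a → merged x ≡ b
  merged-a x e with cls x Fin.≟ a
  ... | yes _ = refl
  ... | no ne = contradiction e ne
  merged-b : ∀ x → cls x ≡ b → merged x ≡ b
  merged-b x e with cls x Fin.≟ a
  ... | yes _ = refl
  ... | no _  = e
  same′ : ∀ e → _ → merged (f e) ≡ merged (g e)
  same′ zero    _ = trans (merged-a (f zero) refl) (sym (merged-b (g zero) refl))
  same′ (suc e) q = merged-cong _ _ (same e q)
  fixed : ∀ x → cls x ≡ x → a ≡ x ⊎ merged x ≡ x
  fixed x e with cls x Fin.≟ a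
  ... | yes e₁ = inj₁ (trans (sym e₁) e)
  ... | no _   = inj₂ e
  le′ : n ≤ # (λ x → merged x Fin.≟ x) + suc (# (P? ∘ suc))
  le′ = begin
    n                                                    ≤⟨ le ⟩
    # (λ x → cls x Fin.≟ x) + # (P? ∘ suc)               ≤⟨ +-monoˡ-≤ _ (#-cover (a Fin.≟_) (λ x → merged x Fin.≟ x) (λ x → cls x Fin.≟ x) fixed) ⟩
    (# (a Fin.≟_) + # (λ x → merged x Fin.≟ x)) + # (P? ∘ suc)
                                                         ≡⟨ cong (λ s → s + # (λ x → merged x Fin.≟ x) + # (P? ∘ suc)) (#-≡ a) ⟩
    suc (# (λ x → merged x Fin.≟ x)) + # (P? ∘ suc)      ≡⟨ +-suc _ _ ⟨
    # (λ x → merged x Fin.≟ x) + suc (# (P? ∘ suc)) ∎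
    where open ≤-Reasoning

module Assignment {n} (cls β : Fin n → Fin n) (N : ℕ) where

  load? : ∀ {A : Fin n → Set} (A? : ∀ r → Dec (A r)) (a : Fin n → Fin n) b → ∀ r → Dec (A r × β (a r) ≡ b)
  load? A? a b r = A? r ×-dec (β (a r) Fin.≟ b)

  -- One member is chosen in each class of `A`, with capacity `N` at every value of `β`: a matching
  -- of classes into vertices of capacity `N`.
  record Balanced {A : Fin n → Set} (A? : ∀ r → Dec (A r)) : Set where
    constructor balanced
    field
      head    : Fin n → Fin n
      head∈   : ∀ {r} → A r → cls (head r) ≡ r
      bounded : ∀ b → # (load? A? head b) ≤ N

  -- The obstruction that remains when no augmenting path exists, similar to a Hall violator. `A`
  -- consists of the classes that have a head so far; the heads counted in `full` belong to classes
  -- of `R` itself.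
  record Saturated (I : Fin n → Set) : Set₁ where
    field
      R A   : Fin n → Set
      R?    : ∀ r → Dec (R r)
      A?    : ∀ r → Dec (A r)
      R⊆I   : ∀ {r} → R r → I r
      some  : ∃ R
      head  : Fin n → Fin n
      head∈ : ∀ {r} → A r → cls (head r) ≡ r
      full  : ∀ y → R (cls y) → N ≤ # (λ r → (A? r ×-dec R? r) ×-dec (β (head r) Fin.≟ β y))

  module Augment {A : Fin n → Set} (A? : ∀ r → Dec (A r)) (r₀ : Fin n) (¬A₀ : ¬ A r₀) where

    -- Alternating paths of at most `i` steps from the class `r₀` that lacks a head. A step leads
    -- from a member `y` of a reached class to any class whose present head has the same `β` as `y`.
    Reach : (Fin n → Fin n) → ℕ → Fin n → Set
    Reach a zero    r = r ≡ r₀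
    Reach a (suc i) r = Reach a i r ⊎ (A r × ∃ λ y → Reach a i (cls y) × β y ≡ β (a r))

    reach? : ∀ a i r → Dec (Reach a i r)
    reach? a zero    r = r Fin.≟ r₀
    reach? a (suc i) r = reach? a i r ⊎-dec (A? r ×-dec Fin.any? λ y → reach? a i (cls y) ×-dec (β y Fin.≟ β (a r)))

    A⁺ : Fin n → Set
    A⁺ r = A r ⊎ r₀ ≡ r

    A⁺? : ∀ r → Dec (A⁺ r)
    A⁺? r = A? r ⊎-dec (r₀ Fin.≟ r)

    reach-mono : ∀ a {i j} → i ≤ j → ∀ z → Reach a i z → Reach a j z
    reach-mono a {i} {j} le z p with m≤n⇒∃[o]m+o≡n le
    ... | o , refl = go o
      where
      go : ∀ o → Reach a (i + o) z
      go zero    = subst (λ j → Reach a j z) (sym (+-identityʳ i)) p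
      go (suc o) = subst (λ j → Reach a j z) (sym (+-suc i o)) (inj₁ (go o))

    -- A path of at most `j` steps uses only heads of classes reached within `j` steps, so the head
    -- of any other class may be moved without breaking it.
    reach-update : ∀ a r y i j → i ≤ j → ¬ Reach a j r → ∀ z → Reach a i z → Reach (update a r y) i z
    reach-update a r y zero    j le ¬r z p = p
    reach-update a r y (suc i) j le ¬r z (inj₁ p) = inj₁ (reach-update a r y i j (<⇒≤ le) ¬r z p)
    reach-update a r y (suc i) j le ¬r z q@(inj₂ (az , w , p , e)) =
      inj₂ (az , w , reach-update a r y i j (<⇒≤ le) ¬r (cls w) p ,
            trans e (cong β (sym (update-other a r y λ { refl → ¬r (reach-mono a le z q) }))))

    Good : (Fin n → Fin n) → Set
    Good a = (∀ {r} → A r → cls (a r) ≡ r) × (∀ b → # (load? A? a b) ≤ N)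

    -- Shifting heads backwards along a shortest alternating path: i bounds the length of the path left.
    augment : ∀ i a → Good a → ∀ y → Reach a i (cls y) → # (load? A? a (β y)) < N → Balanced A⁺?
    augment zero a (a∈ , bd) y refl room = balanced a′ a′∈ bd′
      where
      a′ = update a (cls y) y
      a′∈ : ∀ {r} → A⁺ r → cls (a′ r) ≡ r
      a′∈ (inj₂ refl) = cong cls (update-same a (cls y) y)
      a′∈ {r} (inj₁ ar) = trans (cong cls (update-other a (cls y) y λ { refl → ¬A₀ ar })) (a∈ ar)
      old : ∀ b r → A⁺ r × β (a′ r) ≡ b → (A r × β (a r) ≡ b) ⊎ (cls y ≡ r × β y ≡ b)
      old b r (inj₂ refl , e) = inj₂ (refl , trans (cong β (sym (update-same a (cls y) y))) e)
      old b r (inj₁ ar , e) = inj₁ (ar , trans (cong β (sym (update-other a (cls y) y λ { refl → ¬A₀ ar }))) e)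
      bd′ : ∀ b → # (load? A⁺? a′ b) ≤ N
      bd′ b with β y Fin.≟ b
      ... | no ne = ≤-trans (#-mono (load? A⁺? a′ b) (load? A? a b)
                      λ r p → [ id , (λ q → contradiction (proj₂ q) ne) ]′ (old b r p)) (bd b)
      ... | yes refl = begin
        # (load? A⁺? a′ b)                     ≤⟨ #-cover (cls y Fin.≟_) (load? A? a b) (load? A⁺? a′ b)
                                                    (λ r p → [ inj₂ , (λ q → inj₁ (proj₁ q)) ]′ (old b r p)) ⟩
        # (cls y Fin.≟_) + # (load? A? a b)    ≡⟨ cong (_+ # (load? A? a b)) (#-≡ (cls y)) ⟩
        suc (# (load? A? a b))                 ≤⟨ room ⟩
        N ∎
        where open ≤-Reasoning
    augment (suc i) a good y (inj₁ p) room = augment i a good y p room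
    -- A class already reached in `i` steps has a shorter path, which is used instead; so heads are
    -- moved only along shortest paths.
    augment (suc i) a good@(a∈ , bd) y (inj₂ (ar , w , p , e)) room with reach? a i (cls y)
    ... | yes p′ = augment i a good y p′ room
    ... | no ¬p with β y Fin.≟ β w
    ...   | yes e′ = augment i a good w p (subst (λ b → # (load? A? a b) < N) e′ room)
    -- Making `y` the head of its class uses the room at `β y` and frees a place at `β w`, where the
    -- old head was counted. The path to `w` survives since the class of `y` is not reached in `i`
    -- steps.
    ...   | no ne = augment i a′ (a′∈ , bd′) w (reach-update a r y i i ≤-refl ¬p (cls w) p) room′
      where
      r = cls y
      a′ = update a r y
      a′∈ : ∀ {s} → A s → cls (a′ s) ≡ s
      a′∈ {s} as with s Fin.≟ r
      ... | yes refl = refl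
      ... | no _     = a∈ as
      old : ∀ b s → A s × β (a′ s) ≡ b → (r ≢ s × A s × β (a s) ≡ b) ⊎ (r ≡ s × β y ≡ b)
      old b s (as , e) with s Fin.≟ r
      ... | yes refl = inj₂ (refl , e)
      ... | no ne    = inj₁ (ne ∘ sym , as , e)
      bd′ : ∀ b → # (load? A? a′ b) ≤ N
      bd′ b with β y Fin.≟ b
      ... | no ne = ≤-trans (#-mono (load? A? a′ b) (load? A? a b)
                      λ s p → [ proj₂ , (λ q → contradiction (proj₂ q) ne) ]′ (old b s p)) (bd b)
      ... | yes refl = begin
        # (load? A? a′ b)                      ≤⟨ #-cover (r Fin.≟_) (load? A? a b) (load? A? a′ b)
                                                    (λ s p → [ (λ q → inj₂ (proj₂ q)) , (λ q → inj₁ (proj₁ q)) ]′ (old b s p)) ⟩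
        # (r Fin.≟_) + # (load? A? a b)        ≡⟨ cong (_+ # (load? A? a b)) (#-≡ r) ⟩
        suc (# (load? A? a b))                 ≤⟨ room ⟩
        N ∎
        where open ≤-Reasoning
      room′ : # (load? A? a′ (β w)) < N
      room′ = ≤-trans (#-mono-< (load? A? a′ (β w)) (load? A? a (β w))
                (λ s p → [ proj₂ , (λ q → contradiction (proj₂ q) ne) ]′ (old (β w) s p)) r
                (λ p → [ (λ q → proj₁ q refl) , (λ q → ne (proj₂ q)) ]′ (old (β w) r p)) (ar , sym e)) (bd (β w))

    Stable : (Fin n → Fin n) → ℕ → Set
    Stable a i = ∀ r → Reach a (suc i) r → Reach a i r

    -- Every unstable stage adds a class, so after `n` such stages more than `n` classes would be
    -- reached.
    stabilises : ∀ a → ∃ (Stable a)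
    stabilises a = [ id , (λ big → contradiction (≤-trans big (#≤n (reach? a n))) (<⇒≱ ≤-refl)) ]′ (go n)
      where
      go : ∀ i → ∃ (Stable a) ⊎ suc i ≤ # (reach? a i)
      go zero = inj₂ (#-pos (reach? a 0) r₀ refl)
      go (suc i) with go i
      ... | inj₁ s = inj₁ s
      ... | inj₂ le with Fin.any? (λ r → reach? a (suc i) r ×-dec ¬? (reach? a i r))
      ...   | no ¬w = inj₁ (i , λ r p → decidable-stable (reach? a i r) λ ¬q → ¬w (r , p , ¬q))
      ...   | yes (r , p , ¬q) = inj₂ (≤-trans (s≤s le) (#-mono-< (reach? a i) (reach? a (suc i)) (λ _ → inj₁) r ¬q p))

    -- Once the reached classes are stable, either some `β y` next to them has room and heads can be
    -- shifted to serve `r₀`, or all are full and the reached classes are saturated.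
    step : {I : Fin n → Set} → (∀ {r} → A r → I r) → I r₀ → Balanced A? → Balanced A⁺? ⊎ Saturated I
    step {I} A⊆I I₀ (balanced a a∈ bd) with stabilises a
    ... | i , stable with Fin.any? (λ y → reach? a i (cls y) ×-dec (# (load? A? a (β y)) <? N))
    ...   | yes (y , p , room) = inj₁ (augment i a (a∈ , bd) y p room)
    ...   | no ¬w = inj₂ record
      { R = Reach a i ; A = A ; R? = reach? a i ; A? = A? ; R⊆I = λ {r} → reach⊆ i r
      ; some = r₀ , reach-mono a {0} {i} z≤n r₀ refl ; head = a ; head∈ = a∈
      -- A class whose head is counted at `β y` is reached by one more step, hence by stability is
      -- already in the set.
      ; full = λ y p → ≤-trans (≮⇒≥ λ lt → ¬w (y , p , lt))
                 (#-mono (load? A? a (β y)) (λ r → (A? r ×-dec reach? a i r) ×-dec (β (a r) Fin.≟ β y))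
                   λ { r (ar , e) → (ar , stable r (inj₂ (ar , y , p , sym e))) , e }) }
      where
      reach⊆ : ∀ i r → Reach a i r → I r
      reach⊆ zero    r refl = I₀
      reach⊆ (suc i) r (inj₁ p) = reach⊆ i r p
      reach⊆ (suc i) r (inj₂ (ar , _)) = A⊆I ar

  -- Starting from no heads at all, one class of `I` is added at a time; the fuel bounds the number
  -- of classes still without a head.
  assign : {I : Fin n → Set} (I? : ∀ r → Dec (I r)) → Balanced I? ⊎ Saturated I
  assign {I} I? = go (# I?) {λ _ → ⊥} (λ _ → no id) (λ ())
                    (#-mono (λ r → I? r ×-dec ¬? (no id)) I? λ _ → proj₁)
                    (balanced id (λ ()) λ b → ≤-trans (≤-reflexive (#-none (load? (λ _ → no id) id b) λ _ → proj₁)) z≤n)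
    where
    go : ∀ fuel {A : Fin n → Set} (A? : ∀ r → Dec (A r)) → (∀ {r} → A r → I r) →
         # (λ r → I? r ×-dec ¬? (A? r)) ≤ fuel → Balanced A? → Balanced I? ⊎ Saturated I
    go fuel A? A⊆I le bal with Fin.any? (λ r → I? r ×-dec ¬? (A? r))
    go fuel A? A⊆I le (balanced a a∈ bd) | no ¬w = inj₁ (balanced a (λ {r} → a∈ ∘ I⊆A r)
      λ b → ≤-trans (#-mono (load? I? a b) (load? A? a b) λ { r (ir , e) → I⊆A r ir , e }) (bd b))
      where
      I⊆A : ∀ r → I r → _
      I⊆A r ir = decidable-stable (A? r) λ ¬ar → ¬w (r , ir , ¬ar)
    go zero A? A⊆I le bal | yes (r , w) =
      contradiction (≤-trans (#-pos (λ r → I? r ×-dec ¬? (A? r)) r w) le) λ ()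
    go (suc fuel) A? A⊆I le bal | yes (r , ir , ¬ar) with Augment.step A? r ¬ar A⊆I ir bal
    ... | inj₂ sat = inj₂ sat
    ... | inj₁ bal′ = go fuel (Augment.A⁺? A? r ¬ar) [ A⊆I , (λ { refl → ir }) ]′
                        (≤-pred (≤-trans (#-mono-< (λ s → I? s ×-dec ¬? (Augment.A⁺? A? r ¬ar s)) (λ s → I? s ×-dec ¬? (A? s))
                          (λ { s (is , na) → is , na ∘ inj₁ }) r (λ q → proj₂ q (inj₂ refl)) (ir , ¬ar)) le)) bal′

-- Recolouring

Adj : ∀ {n} → Graph n → Fin n → Fin n → Set
Adj G u v = T (adj G u v)

adj? : ∀ {n} (G : Graph n) u v → Dec (Adj G u v)
adj? G u v = T? (adj G u v)

Adj-sym : ∀ {n} (G : Graph n) {u v} → Adj G u v → Adj G v u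
Adj-sym G {u} {v} = subst T (adj-sym G u v)

Adj-irrefl : ∀ {n} (G : Graph n) {u} → ¬ Adj G u u
Adj-irrefl G {u} a = subst T (loopless G u) a

Dist≤2-sym : ∀ {n} (G : Graph n) {u v} → Dist≤2 G u v → Dist≤2 G v u
Dist≤2-sym G (inj₁ a) = inj₁ (Adj-sym G a)
Dist≤2-sym G (inj₂ (w , a , b)) = inj₂ (w , Adj-sym G b , Adj-sym G a)

Conf : ∀ {n} → Graph n → Fin n → Fin n → Set
Conf G u v = u ≢ v × Dist≤2 G u v

conf? : ∀ {n} (G : Graph n) u v → Dec (Conf G u v)
conf? G u v = ¬? (u Fin.≟ v) ×-dec (adj? G u v ⊎-dec Fin.any? λ w → adj? G u w ×-dec adj? G w v)

Conf-sym : ∀ {n} (G : Graph n) {u v} → Conf G u v → Conf G v u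
Conf-sym G (ne , d) = ne ∘ sym , Dist≤2-sym G d

module _ {n} (G : Graph n) {D : Fin n → Fin n → Set} (D? : ∀ u v → Dec (D u v)) (D-sym : ∀ {u v} → D u v → D v u) where

  deleteEdges : Graph n
  deleteEdges = record
    { adj = λ u v → adj G u v ∧ not (does (D? u v))
    ; sym = λ u v → cong₂ (λ a d → a ∧ not d) (adj-sym G u v) (does-⇔ (mk⇔ D-sym D-sym) (D? u v) (D? v u))
    ; loopless = λ v → cong (_∧ not (does (D? v v))) (loopless G v) }

  kept : ∀ {u v} → Adj G u v → ¬ D u v → Adj deleteEdges u v
  kept {u} {v} a ¬d with adj G u v | D? u v
  ... | true | yes d = ⊥-elim (¬d d)
  ... | true | no _  = _

  deleted⊆ : ∀ {u v} → Adj deleteEdges u v → Adj G u v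
  deleted⊆ {u} {v} a = proj₁ (Equivalence.to (T-∧ {adj G u v}) a)

  gone : ∀ {u v} → D u v → ¬ Adj deleteEdges u v
  gone {u} {v} d a with adj G u v | D? u v
  ... | true  | no ¬d = ¬d d

  -- If no deleted edge lies on a path of length at most two between distinct vertices of `W`, a
  -- colouring of the square of the smaller graph remains proper on `W`.
  Dist≤2-kept : (W : Fin n → Set) → (∀ {u v} → W u → W v → ¬ D u v) →
    (∀ {u v w} → W u → W v → u ≢ v → Adj G u w → Adj G w v → ¬ D u w) →
    ∀ {u v} → W u → W v → Conf G u v → Dist≤2 deleteEdges u v
  Dist≤2-kept W h₁ h₂ wu wv (ne , inj₁ a) = inj₁ (kept a (h₁ wu wv))
  Dist≤2-kept W h₁ h₂ wu wv (ne , inj₂ (w , a , b)) =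
    inj₂ (w , kept a (h₂ wu wv ne a b) ,
          kept b (h₂ wv wu (ne ∘ sym) (Adj-sym G b) (Adj-sym G a) ∘ D-sym))

Colouring : ∀ {n} → Graph n → (Fin n → List ℕ) → Set
Colouring {n} G L = Σ (Fin n → ℕ) λ c → (∀ v → c v ∈ L v) × (∀ u v → u ≢ v → Dist≤2 G u v → c u ≢ c v)

module Extension {n} (G : Graph n) (k : ℕ) (L : Fin n → List ℕ) (L-ok : ∀ v → Unique (L v) × k < length (L v)) where

  ProperOn : (Fin n → Set) → (Fin n → ℕ) → Set
  ProperOn W c = (∀ v → W v → c v ∈ L v) × (∀ u v → W u → W v → Conf G u v → c u ≢ c v)

  Free : Fin n → Set
  Free v = # (conf? G v) ≤ k

  available : ∀ {W : Fin n → Set} (W? : ∀ v → Dec (W v)) c v →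
    ∃ λ L′ → Unique L′ × (∀ z → z ∈ L′ → z ∈ L v × (∀ u → W u × Conf G v u → c u ≢ z)) ×
             length (L v) ≤ # (λ u → W? u ×-dec conf? G v u) + length L′
  available W? c v = avoid (λ u → W? u ×-dec conf? G v u) c (L v) (proj₁ (L-ok v))

  -- Greedy colouring: a free vertex meets at most `k` colours and its list has more than `k`,
  -- whatever the order.
  extend-free : ∀ fuel {W : Fin n → Set} (W? : ∀ v → Dec (W v)) → # (λ v → ¬? (W? v)) ≤ fuel →
    (∀ v → ¬ W v → Free v) → ∀ c → ProperOn W c → Colouring G L
  extend-free fuel W? le free c ok with Fin.any? (λ v → ¬? (W? v))
  extend-free fuel W? le free c (c∈ , proper) | no ¬w =
    c , (λ v → c∈ v (all v)) , λ u v ne d → proper u v (all u) (all v) (ne , d)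
    where all = λ v → decidable-stable (W? v) λ ¬p → ¬w (v , ¬p)
  extend-free zero W? le free c ok | yes (v , ¬p) = contradiction (≤-trans (#-pos (λ v → ¬? (W? v)) v ¬p) le) λ ()
  extend-free (suc fuel) {W} W? le free c (c∈ , proper) | yes (v , ¬p) with available W? c v
  ... | L′ , _ , L′-ok , len with nonempty-∈ L′ (+-cancelˡ-< k 0 _ (≤-trans (s≤s (≤-reflexive (+-identityʳ k)))
            (≤-trans (proj₂ (L-ok v)) (≤-trans len (+-monoˡ-≤ (length L′)
              (≤-trans (#-mono (λ u → W? u ×-dec conf? G v u) (conf? G v) λ _ → proj₂) (free v ¬p)))))))
  ...   | z , z∈ = extend-free fuel (λ u → W? u ⊎-dec (v Fin.≟ u))
      (≤-pred (≤-trans (#-mono-< (λ u → ¬? (W? u ⊎-dec (v Fin.≟ u))) (λ u → ¬? (W? u))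
        (λ _ ¬q → ¬q ∘ inj₁) v (λ ¬q → ¬q (inj₂ refl)) ¬p) le))
      (λ u ¬q → free u (¬q ∘ inj₁)) c′ (c′∈ , proper′)
    where
    c′ = update c v z
    c′-old : ∀ {u} → W u → c′ u ≡ c u
    c′-old w = update-other c v z λ { refl → ¬p w }
    c′-new : c′ v ≡ z
    c′-new = update-same c v z
    c′∈ : ∀ u → W u ⊎ v ≡ u → c′ u ∈ L u
    c′∈ u (inj₁ w) = subst (_∈ L u) (sym (c′-old w)) (c∈ u w)
    c′∈ u (inj₂ refl) = subst (_∈ L u) (sym c′-new) (proj₁ (L′-ok z z∈))
    new : ∀ u → W u → Conf G v u → c′ u ≢ c′ v
    new u w cf e = proj₂ (L′-ok z z∈) u (w , cf) (trans (sym (c′-old w)) (trans e c′-new))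
    proper′ : ∀ u w → W u ⊎ v ≡ u → W w ⊎ v ≡ w → Conf G u w → c′ u ≢ c′ w
    proper′ u w (inj₁ p) (inj₁ q) cf e = proper u w p q cf (trans (sym (c′-old p)) (trans e (c′-old q)))
    proper′ u w (inj₁ p) (inj₂ refl) cf e = new u p (Conf-sym G cf) e
    proper′ u w (inj₂ refl) (inj₁ q) cf e = new w q cf (sym e)
    proper′ u w (inj₂ refl) (inj₂ refl) cf e = proj₁ cf refl

  module _ (p q : Fin n → Fin n) (ρ σ : Fin n → ℕ)
    (ρ-inj : ∀ x y → ρ x ≡ ρ y → x ≡ y) (σ-inj : ∀ x y → σ x ≡ σ y → x ≡ y) where
    open ListColouring p q ρ σ ρ-inj σ-inj

    -- Each conflict with a coloured vertex costs a list at most one colour; by the bound on the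
    -- sum, the rest of the list still exceeds the outdegree, as the kernel method demands.
    extend-galvin : {W X : Fin n → Set} (W? : ∀ v → Dec (W v)) (X? : ∀ v → Dec (X v)) →
      (∀ x y → X x → X y → Conf G x y → Meet x y) →
      (∀ x → X x → # (λ u → W? u ×-dec conf? G x u) + earlier X? x ≤ k) →
      ∀ c → ProperOn W c → ∃ (ProperOn (λ v → W v ⊎ X v))
    extend-galvin {W} {X} W? X? meet room c (c∈ , proper) = c′ , c′∈ , proper′
      where
      L′ : Fin n → List ℕ
      L′ x = proj₁ (available W? c x)
      L′-ok = λ x → proj₁ (proj₂ (proj₂ (available W? c x)))
      long : ∀ x → X x → Unique (L′ x) × earlier X? x < length (L′ x)
      long x px = proj₁ (proj₂ (available W? c x)) ,
        +-cancelˡ-< (# (λ u → W? u ×-dec conf? G x u)) _ _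
          (≤-trans (s≤s (room x px)) (≤-trans (proj₂ (L-ok x)) (proj₂ (proj₂ (proj₂ (available W? c x))))))
      solution = galvin (# X?) X? L′ ≤-refl long
      d = proj₁ solution
      c′ : Fin n → ℕ
      c′ v with W? v
      ... | yes _ = c v
      ... | no _  = d v
      d∈ : ∀ x → X x → d x ∈ L x × (∀ u → W u × Conf G x u → c u ≢ d x)
      d∈ x px = L′-ok x (d x) (proj₁ (proj₂ solution) x px)
      right : ∀ {v} → ¬ W v → W v ⊎ X v → X v
      right ¬w = [ (λ w → contradiction w ¬w) , id ]′
      c′∈ : ∀ v → W v ⊎ X v → c′ v ∈ L v
      c′∈ v s with W? v
      ... | yes w = c∈ v w
      ... | no ¬w = proj₁ (d∈ v (right ¬w s))
      proper′ : ∀ u v → W u ⊎ X u → W v ⊎ X v → Conf G u v → c′ u ≢ c′ v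
      proper′ u v s t cf with W? u | W? v
      ... | yes w | yes w′ = proper u v w w′ cf
      ... | yes w | no ¬w  = proj₂ (d∈ v (right ¬w t)) u (w , Conf-sym G cf)
      ... | no ¬w | yes w  = proj₂ (d∈ u (right ¬w s)) v (w , cf) ∘ sym
      ... | no ¬w | no ¬w′ = proj₂ (proj₂ solution) u v (right ¬w s) (right ¬w′ t) (proj₁ cf)
                               (meet u v (right ¬w s) (right ¬w′ t) cf)

  Dist≤2-colour : ∀ {H : Graph n} {W : Fin n → Set} → (∀ {u v} → W u → W v → Conf G u v → Dist≤2 H u v) →
    (c : Colouring H L) → ProperOn W (proj₁ c)
  Dist≤2-colour keep (c , c∈ , proper) = (λ v _ → c∈ v) , λ u v wu wv cf → proper u v (proj₁ cf) (keep wu wv cf)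

-- Discharging

-- Average degree below `3 - 1/m` on every nonempty `S`, with denominators cleared.
Sparse : ∀ {n} → ℕ → Graph n → Set
Sparse {n} m G = ∀ (S : Fin n → Bool) → 0 < count S → m * twiceEdges G S + count S < 3 * m * count S

≤-slack : ∀ {a b} x → b ≡ a + x → a ≤ b
≤-slack {a} x refl = m≤m+n a x

-- The discharging inequality at a vertex, where 2m = q + 1 and a big vertex gives q (out of q + 1)
-- to each neighbour. Here s, b, f, t are the indicators of being non-isolated, big, a link and a tip,
-- d is the degree, and e, j are the numbers of links and of big vertices in the neighbourhood.
Discharged : (m q s b f t d e j : ℕ) → Set
Discharged m q s b f t d e j =
  3 * (q + 1) * s + q * (b * d) + (q + 1) * m * b + (q + 1) * e + 2 * f ≤
  (q + 1) * d + 2 * s + (q + 1) * f + q * j + (q + 1) * t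

module _ (m q : ℕ) where

  discharged-isolated : ∀ {s b f t d e j} → s ≡ 0 → b ≡ 0 → f ≡ 0 → e ≡ 0 → Discharged m q s b f t d e j
  discharged-isolated {t = t} {d} {j = j} refl refl refl refl = ≤-slack _ (eq m q t d j)
    where
    abstract
      eq : ∀ m q t d j → (q + 1) * d + 2 * 0 + (q + 1) * 0 + q * j + (q + 1) * t ≡
           (3 * (q + 1) * 0 + q * (0 * d) + (q + 1) * m * 0 + (q + 1) * 0 + 2 * 0) +
           ((q + 1) * d + q * j + (q + 1) * t)
      eq = solve-∀

  -- After giving `q` along each edge a big vertex keeps `d` of its charge `(q + 1) d`. The
  -- threshold `(q + 1) (m + 3)` pays for the demand `3 (q + 1)` and for the surplus `(q + 1) m`.
  discharged-big : ∀ {s b f t d e j} → s ≡ 1 → b ≡ 1 → f ≡ 0 → e ≡ 0 → (q + 1) * (m + 3) ≤ d →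
    Discharged m q s b f t d e j
  discharged-big {t = t} {d} {j = j} refl refl refl refl le with m≤n⇒∃[o]m+o≡n le
  ... | x , refl = ≤-slack _ (eq m q t x j)
    where
    abstract
      eq : ∀ m q t x j → (q + 1) * ((q + 1) * (m + 3) + x) + 2 * 1 + (q + 1) * 0 + q * j + (q + 1) * t ≡
           (3 * (q + 1) * 1 + q * (1 * ((q + 1) * (m + 3) + x)) + (q + 1) * m * 1 + (q + 1) * 0 + 2 * 0) +
           (x + 2 + q * j + (q + 1) * t)
      eq = solve-∀

  discharged-link : ∀ {s b f t d e j} → s ≡ 1 → b ≡ 0 → f ≡ 1 → e ≡ 0 → d ≡ 2 → Discharged m q s b f t d e j
  discharged-link {t = t} {j = j} refl refl refl refl refl = ≤-slack _ (eq m q t j)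
    where
    abstract
      eq : ∀ m q t j → (q + 1) * 2 + 2 * 1 + (q + 1) * 1 + q * j + (q + 1) * t ≡
           (3 * (q + 1) * 1 + q * (0 * 2) + (q + 1) * m * 0 + (q + 1) * 0 + 2 * 1) +
           (q * j + (q + 1) * t)
      eq = solve-∀

  discharged-lonely : ∀ {s b f t d e j} → s ≡ 1 → b ≡ 0 → f ≡ 0 → e ≡ 0 → 3 ≤ d → Discharged m q s b f t d e j
  discharged-lonely {t = t} {j = j} refl refl refl refl le with m≤n⇒∃[o]m+o≡n le
  ... | x , refl = ≤-slack _ (eq m q t x j)
    where
    abstract
      eq : ∀ m q t x j → (q + 1) * (3 + x) + 2 * 1 + (q + 1) * 0 + q * j + (q + 1) * t ≡
           (3 * (q + 1) * 1 + q * (0 * (3 + x)) + (q + 1) * m * 0 + (q + 1) * 0 + 2 * 0) +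
           ((q + 1) * x + 2 + q * j + (q + 1) * t)
      eq = solve-∀

  -- The one deficient type: without the term `(q + 1) t` the charge would fall short by `q`. All
  -- other cases hold for arbitrary `t`, so deficits are charged to tips alone.
  discharged-tip : ∀ {s b f t d e j} → s ≡ 1 → b ≡ 0 → f ≡ 0 → t ≡ 1 → j ≡ 1 → e + 1 ≡ d → Discharged m q s b f t d e j
  discharged-tip {e = e} refl refl refl refl refl refl = ≤-slack _ (eq m q e)
    where
    abstract
      eq : ∀ m q e → (q + 1) * (e + 1) + 2 * 1 + (q + 1) * 0 + q * 1 + (q + 1) * 1 ≡
           (3 * (q + 1) * 1 + q * (0 * (e + 1)) + (q + 1) * m * 0 + (q + 1) * e + 2 * 0) + 1
      eq = solve-∀

  discharged-one : ∀ {s b f t d e j} → s ≡ 1 → b ≡ 0 → f ≡ 0 → j ≡ 1 → e + 2 ≤ d → Discharged m q s b f t d e j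
  discharged-one {t = t} {e = e} refl refl refl refl le with m≤n⇒∃[o]m+o≡n le
  ... | x , refl = ≤-slack _ (eq m q t x e)
    where
    abstract
      eq : ∀ m q t x e → (q + 1) * (e + 2 + x) + 2 * 1 + (q + 1) * 0 + q * 1 + (q + 1) * t ≡
           (3 * (q + 1) * 1 + q * (0 * (e + 2 + x)) + (q + 1) * m * 0 + (q + 1) * e + 2 * 0) +
           ((q + 1) * x + 1 + (q + 1) * t)
      eq = solve-∀

  discharged-two : ∀ {s b f t d e j} → s ≡ 1 → b ≡ 0 → f ≡ 0 → 2 ≤ j → e + j ≤ d → Discharged m q s b f t d e j
  discharged-two {t = t} {e = e} refl refl refl 2≤j le with m≤n⇒∃[o]m+o≡n 2≤j
  ... | y , refl with m≤n⇒∃[o]m+o≡n le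
  ...   | x , refl = ≤-slack _ (eq m q t x y e)
    where
    abstract
      eq : ∀ m q t x y e → (q + 1) * (e + (2 + y) + x) + 2 * 1 + (q + 1) * 0 + q * (2 + y) + (q + 1) * t ≡
           (3 * (q + 1) * 1 + q * (0 * (e + (2 + y) + x)) + (q + 1) * m * 0 + (q + 1) * e + 2 * 0) +
           ((q + 1) + (q + 1) * (y + x) + q * y + (q + 1) * t)
      eq = solve-∀

sumF-linear : ∀ {n} (a b c d e : ℕ) (f g h i k : Fin n → ℕ) →
  sumF (λ x → a * f x + b * g x + c * h x + d * i x + e * k x) ≡
  a * sumF f + b * sumF g + c * sumF h + d * sumF i + e * sumF k
sumF-linear a b c d e f g h i k =
  trans (sumF-+ (λ x → a * f x + b * g x + c * h x + d * i x) (λ x → e * k x)) (cong₂ _+_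
    (trans (sumF-+ (λ x → a * f x + b * g x + c * h x) (λ x → d * i x)) (cong₂ _+_
      (trans (sumF-+ (λ x → a * f x + b * g x) (λ x → c * h x)) (cong₂ _+_
        (trans (sumF-+ (λ x → a * f x) (λ x → b * g x)) (cong₂ _+_ (sumF-* a f) (sumF-* b g)))
        (sumF-* c h)))
      (sumF-* d i)))
    (sumF-* e k))

-- The charge `q X` sent by big vertices cancels against the charge received, and sparsity makes
-- `(q + 1) D + 2 S` smaller than `3 (q + 1) S`. What is left is twice the claim.
total-charge : ∀ m q S X B F D T E → 2 * m ≡ q + 1 → E ≡ 2 * F →
  3 * (q + 1) * S + q * X + (q + 1) * m * B + (q + 1) * E + 2 * F ≤
  (q + 1) * D + 2 * S + (q + 1) * F + q * X + (q + 1) * T →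
  m * D + S < 3 * m * S → m * (m * B) + (m + 1) * F < m * T
total-charge m q S X B F D T E 2m≡ refl le sparse = *-cancelˡ-< 2 _ _
  (+-cancelˡ-< (3 * (q + 1) * S + (q + 1) * F + q * X) _ _ chain)
  where
  open ≤-Reasoning
  abstract
    eq₁ : ∀ m h S X B F q → 3 * h * S + h * F + q * X + (h * (m * B) + (h + 2) * F) ≡
          3 * h * S + q * X + h * m * B + h * (2 * F) + 2 * F
    eq₁ = solve-∀
    eq₂ : ∀ m D S → 2 * m * D + 2 * S ≡ 2 * (m * D + S)
    eq₂ = solve-∀
    eq₃ : ∀ m S → 2 * (3 * m * S) ≡ 3 * (2 * m) * S
    eq₃ = solve-∀
    eq₄ : ∀ m B F → 2 * (m * (m * B) + (m + 1) * F) ≡ 2 * m * (m * B) + (2 * m + 2) * F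
    eq₄ = solve-∀
  small : (q + 1) * D + 2 * S < 3 * (q + 1) * S
  small = subst (λ h → h * D + 2 * S < 3 * h * S) 2m≡ (begin-strict
    2 * m * D + 2 * S   ≡⟨ eq₂ m D S ⟩
    2 * (m * D + S)     <⟨ *-monoʳ-< 2 sparse ⟩
    2 * (3 * m * S)     ≡⟨ eq₃ m S ⟩
    3 * (2 * m) * S     ∎)
  chain : 3 * (q + 1) * S + (q + 1) * F + q * X + 2 * (m * (m * B) + (m + 1) * F) <
          3 * (q + 1) * S + (q + 1) * F + q * X + 2 * (m * T)
  chain = begin-strict
    3 * (q + 1) * S + (q + 1) * F + q * X + 2 * (m * (m * B) + (m + 1) * F)
      ≡⟨ cong (3 * (q + 1) * S + (q + 1) * F + q * X +_) (trans (eq₄ m B F) (cong (λ h → h * (m * B) + (h + 2) * F) 2m≡)) ⟩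
    3 * (q + 1) * S + (q + 1) * F + q * X + ((q + 1) * (m * B) + (q + 1 + 2) * F)
      ≡⟨ eq₁ m (q + 1) S X B F q ⟩
    3 * (q + 1) * S + q * X + (q + 1) * m * B + (q + 1) * (2 * F) + 2 * F
      ≤⟨ le ⟩
    (q + 1) * D + 2 * S + (q + 1) * F + q * X + (q + 1) * T
      <⟨ +-monoˡ-< _ (+-monoˡ-< _ (+-monoˡ-< _ small)) ⟩
    3 * (q + 1) * S + (q + 1) * F + q * X + (q + 1) * T
      ≡⟨ cong (3 * (q + 1) * S + (q + 1) * F + q * X +_) (trans (cong (_* T) (sym 2m≡)) (*-assoc 2 m T)) ⟩
    3 * (q + 1) * S + (q + 1) * F + q * X + 2 * (m * T) ∎

-- Double counting of the edges into `P`. It balances the charge sent by big vertices and gives the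
-- number of edges at links.
neighbours-sum : ∀ {n} (G : Graph n) {P : Fin n → Set} (P? : ∀ v → Dec (P v)) →
  sumF (λ u → # (λ v → adj? G u v ×-dec P? v)) ≡ sumF (λ v → χ (P? v) * degree G v)
neighbours-sum G P? = begin
  sumF (λ u → # (λ v → adj? G u v ×-dec P? v))              ≡⟨ sumF-cong (λ u → #≡sumF (λ v → adj? G u v ×-dec P? v)) ⟩
  sumF (λ u → sumF (λ v → χ (adj? G u v ×-dec P? v)))       ≡⟨ sumF-swap (λ u v → χ (adj? G u v ×-dec P? v)) ⟩
  sumF (λ v → sumF (λ u → χ (adj? G u v ×-dec P? v)))       ≡⟨ sumF-cong (λ v → sumF-cong λ u → flip u v) ⟩
  sumF (λ v → sumF (λ u → χ (P? v) * χ (adj? G v u)))       ≡⟨ sumF-cong (λ v → sumF-* (χ (P? v)) (λ u → χ (adj? G v u))) ⟩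
  sumF (λ v → χ (P? v) * sumF (λ u → χ (adj? G v u)))       ≡⟨ sumF-cong (λ v → cong (χ (P? v) *_) (#≡sumF (adj? G v))) ⟨
  sumF (λ v → χ (P? v) * degree G v) ∎
  where
  open ≡-Reasoning
  flip : ∀ u v → χ (adj? G u v ×-dec P? v) ≡ χ (P? v) * χ (adj? G v u)
  flip u v = trans (χ-× (adj? G u v) (P? v)) (trans (*-comm _ (χ (P? v)))
    (cong (λ b → χ (P? v) * (if b then 1 else 0)) (adj-sym G u v)))

-- Big vertices, links and tips

module Structure {n} (G : Graph n) (m q : ℕ) (2m≡q+1 : 2 * m ≡ q + 1) (1≤m : 1 ≤ m) where

  M : ℕ
  M = 2 * m * (m + 3)

  8≤M : 8 ≤ M
  8≤M = *-mono-≤ (*-monoʳ-≤ 2 1≤m) (+-monoˡ-≤ 3 1≤m)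

  d : Fin n → ℕ
  d = degree G

  Big : Fin n → Set
  Big u = M ≤ d u

  big? : ∀ u → Dec (Big u)
  big? u = M ≤? d u

  bigs? : ∀ u v → Dec (Adj G u v × Big v)
  bigs? u v = adj? G u v ×-dec big? v

  j : Fin n → ℕ
  j u = # (bigs? u)

  Lonely : Fin n → Set
  Lonely u = ¬ Big u × j u ≡ 0

  Link : Fin n → Set
  Link u = d u ≡ 2 × j u ≡ 0

  link? : ∀ u → Dec (Link u)
  link? u = (d u ≟ 2) ×-dec (j u ≟ 0)

  links? : ∀ u v → Dec (Adj G u v × Link v)
  links? u v = adj? G u v ×-dec link? v

  e : Fin n → ℕ
  e u = # (links? u)

  Tip : Fin n → Set
  Tip u = ¬ Big u × j u ≡ 1 × e u + 1 ≡ d u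

  tip? : ∀ u → Dec (Tip u)
  tip? u = ¬? (big? u) ×-dec ((j u ≟ 1) ×-dec (e u + 1 ≟ d u))

  link-lonely : ∀ {u} → Link u → Lonely u
  link-lonely (d≡2 , j≡0) = (λ b → contradiction (≤-trans 8≤M (≤-trans b (≤-reflexive d≡2))) λ { (s≤s (s≤s ())) }) , j≡0

  no-big : ∀ {u v} → j u ≡ 0 → Adj G u v → ¬ Big v
  no-big {u} {v} j≡0 a b = contradiction j≡0 (>⇒≢ (#-pos (bigs? u) v (a , b)))

  e+j≤d : ∀ u → e u + j u ≤ d u
  e+j≤d u = #-disjoint (links? u) (bigs? u) (adj? G u) (λ _ → proj₁) (λ _ → proj₁)
    λ v p q → proj₁ (link-lonely (proj₂ p)) (proj₂ q)

  Nonisolated : Fin n → Set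
  Nonisolated u = 0 < d u

  nonisolated? : ∀ u → Dec (Nonisolated u)
  nonisolated? u = 0 <? d u

  module Counting (sparse : Sparse m G) (no-leaf : ∀ u → d u ≢ 1)
    (no-lonely-link : ∀ {u v} → Lonely u → Link v → ¬ Adj G u v) (edge : ∃ Nonisolated) where

    discharged : ∀ u → Discharged m q (χ (nonisolated? u)) (χ (big? u)) (χ (link? u)) (χ (tip? u)) (d u) (e u) (j u)
    discharged u with nonisolated? u
    ... | no ¬s = discharged-isolated m q (χ-no (nonisolated? u) ¬s)
        (χ-no (big? u) λ b → ¬s (≤-trans (≤-trans (s≤s z≤n) 8≤M) b))
        (χ-no (link? u) λ p → ¬s (≤-trans (s≤s z≤n) (≤-reflexive (sym (proj₁ p)))))
        (n≤0⇒n≡0 (≤-trans (m≤m+n (e u) (j u)) (≤-trans (e+j≤d u) (≮⇒≥ ¬s))))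
    ... | yes s with big? u
    ...   | yes b = discharged-big m q (χ-yes (nonisolated? u) s) (χ-yes (big? u) b)
        (χ-no (link? u) λ p → proj₁ (link-lonely p) b)
        (#-none (links? u) λ v p → no-big (proj₂ (proj₂ p)) (Adj-sym G (proj₁ p)) b)
        (subst (λ h → h * (m + 3) ≤ d u) 2m≡q+1 b)
    ...   | no ¬b with j u ≟ 0
    ...     | yes j≡0 with link? u
    ...       | yes p = discharged-link m q (χ-yes (nonisolated? u) s) (χ-no (big? u) ¬b) (χ-yes (link? u) p)
        (#-none (links? u) λ v r → no-lonely-link (¬b , j≡0) (proj₂ r) (proj₁ r)) (proj₁ p)
    ...       | no ¬p = discharged-lonely m q (χ-yes (nonisolated? u) s) (χ-no (big? u) ¬b) (χ-no (link? u) ¬p)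
        (#-none (links? u) λ v r → no-lonely-link (¬b , j≡0) (proj₂ r) (proj₁ r))
        (≤∧≢⇒< (≤∧≢⇒< s (no-leaf u ∘ sym)) λ 2≡d → ¬p (sym 2≡d , j≡0))
    discharged u | yes s | no ¬b | no j≢0 with j u ≟ 1
    ... | no j≢1 = discharged-two m q (χ-yes (nonisolated? u) s) (χ-no (big? u) ¬b) (χ-no (link? u) (j≢0 ∘ proj₂))
        (≤∧≢⇒< (n≢0⇒n>0 j≢0) (j≢1 ∘ sym)) (e+j≤d u)
    ... | yes j≡1 with e u + 1 ≟ d u
    ...   | yes e≡ = discharged-tip m q (χ-yes (nonisolated? u) s) (χ-no (big? u) ¬b) (χ-no (link? u) (j≢0 ∘ proj₂))
        (χ-yes (tip? u) (¬b , j≡1 , e≡)) j≡1 e≡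
    ...   | no e≢ = discharged-one m q (χ-yes (nonisolated? u) s) (χ-no (big? u) ¬b) (χ-no (link? u) (j≢0 ∘ proj₂)) j≡1
        (subst (_≤ d u) (sym (+-suc (e u) 1)) (≤∧≢⇒< (subst (λ i → e u + i ≤ d u) j≡1 (e+j≤d u)) e≢))

    -- Both ends of an edge are nonisolated, so sparsity may be applied to these vertices only; an
    -- isolated vertex would have no charge to meet its demand.
    Σd≤twiceEdges : sumF d ≤ twiceEdges G (λ u → does (nonisolated? u))
    Σd≤twiceEdges = sumF-mono λ u → #-mono (adj? G u)
      (λ v → T? (does (nonisolated? u) ∧ (does (nonisolated? v) ∧ adj G u v))) λ v a →
        Equivalence.from T-∧ (T-does (nonisolated? u) (#-pos (adj? G u) v a) ,
          Equivalence.from T-∧ (T-does (nonisolated? v) (#-pos (adj? G v) u (Adj-sym G a)) , a))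
      where
      T-does : {A : Set} (a? : Dec A) → A → T (does a?)
      T-does (yes _) _ = _
      T-does (no ¬a) a = ¬a a

    -- Divided by `m`: the tips outnumber `m` per big vertex plus `1 + 1/m` per link. The extra
    -- `1/m` per link is what later rules out too many classes with more than `m` vertices.
    many-tips : m * (m * # big?) + (m + 1) * # link? < m * # tip?
    many-tips = total-charge m q (# nonisolated?) (sumF j) (# big?) (# link?) (sumF d) (# tip?) (sumF e) 2m≡q+1 Σe le
      (≤-trans (s≤s (+-monoˡ-≤ (# nonisolated?) (*-monoʳ-≤ m Σd≤twiceEdges)))
        (sparse (λ u → does (nonisolated? u)) (#-pos nonisolated? (proj₁ edge) (proj₂ edge))))
      where
      open ≤-Reasoning
      Σe : sumF e ≡ 2 * # link?
      Σe = trans (neighbours-sum G link?) (trans (sumF-cong pt) (trans (sumF-* 2 (λ u → χ (link? u))) (cong (2 *_) (sym (#≡sumF link?)))))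
        where
        pt : ∀ u → χ (link? u) * d u ≡ 2 * χ (link? u)
        pt u = χ-* (link? u) proj₁
      le : 3 * (q + 1) * # nonisolated? + q * sumF j + (q + 1) * m * # big? + (q + 1) * sumF e + 2 * # link? ≤
           (q + 1) * sumF d + 2 * # nonisolated? + (q + 1) * # link? + q * sumF j + (q + 1) * # tip?
      le rewrite #≡sumF nonisolated? | #≡sumF big? | #≡sumF link? | #≡sumF tip? = begin
        3 * (q + 1) * sumF (λ u → χ (nonisolated? u)) + q * sumF j + (q + 1) * m * sumF (λ u → χ (big? u)) + (q + 1) * sumF e + 2 * sumF (λ u → χ (link? u))
          ≡⟨ cong (λ x → 3 * (q + 1) * sumF (λ u → χ (nonisolated? u)) + q * x + (q + 1) * m * sumF (λ u → χ (big? u)) + (q + 1) * sumF e + 2 * sumF (λ u → χ (link? u))) (neighbours-sum G big?) ⟩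
        3 * (q + 1) * sumF (λ u → χ (nonisolated? u)) + q * sumF (λ u → χ (big? u) * d u) + (q + 1) * m * sumF (λ u → χ (big? u)) + (q + 1) * sumF e + 2 * sumF (λ u → χ (link? u))
          ≡⟨ sumF-linear (3 * (q + 1)) q ((q + 1) * m) (q + 1) 2 (λ u → χ (nonisolated? u)) (λ u → χ (big? u) * d u) (λ u → χ (big? u)) e (λ u → χ (link? u)) ⟨
        sumF (λ u → 3 * (q + 1) * χ (nonisolated? u) + q * (χ (big? u) * d u) + (q + 1) * m * χ (big? u) + (q + 1) * e u + 2 * χ (link? u))
          ≤⟨ sumF-mono discharged ⟩
        sumF (λ u → (q + 1) * d u + 2 * χ (nonisolated? u) + (q + 1) * χ (link? u) + q * j u + (q + 1) * χ (tip? u))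
          ≡⟨ sumF-linear (q + 1) 2 (q + 1) q (q + 1) d (λ u → χ (nonisolated? u)) (λ u → χ (link? u)) j (λ u → χ (tip? u)) ⟩
        (q + 1) * sumF d + 2 * sumF (λ u → χ (nonisolated? u)) + (q + 1) * sumF (λ u → χ (link? u)) + q * sumF j + (q + 1) * sumF (λ u → χ (tip? u)) ∎

-- Classes of vertices joined through links

module Clusters {n} (G : Graph n) (m q : ℕ) (2m≡q+1 : 2 * m ≡ q + 1) (1≤m : 1 ≤ m) where
  open Structure G m q 2m≡q+1 1≤m public

  ends : ∀ v → ∃ λ x → ∃ λ y → Link v → ∀ w → Adj G v w → w ≡ x ⊎ w ≡ y
  ends v with link? v
  ... | yes (d≡2 , _) = let x , y , h = #-two (adj? G v) d≡2 in x , y , λ _ → h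
  -- Default ends for a vertex that is not a link.
  ... | no ¬l = v , v , λ l → contradiction l ¬l

  end₁ end₂ : Fin n → Fin n
  end₁ v = proj₁ (ends v)
  end₂ v = proj₁ (proj₂ (ends v))

  abstract
    -- Each link acts as an edge between its two neighbours, on the set of all vertices; so vertices
    -- exceed representatives by at most the number of links.
    classes : ∃ λ (cls : Fin n → Fin n) →
      (∀ v → Link v → cls (end₁ v) ≡ cls (end₂ v)) × n ≤ # (λ x → cls x Fin.≟ x) + # link?
    classes = components link? end₁ end₂

  cls : Fin n → Fin n
  cls = proj₁ classes

  cls-link : ∀ {v x y} → Link v → Adj G v x → Adj G v y → cls x ≡ cls y
  cls-link {v} {x} {y} l ax ay with proj₂ (proj₂ (ends v)) l x ax | proj₂ (proj₂ (ends v)) l y ay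
  ... | inj₁ refl | inj₁ refl = refl
  ... | inj₁ refl | inj₂ refl = proj₁ (proj₂ classes) v l
  ... | inj₂ refl | inj₁ refl = sym (proj₁ (proj₂ classes) v l)
  ... | inj₂ refl | inj₂ refl = refl

  rep? : ∀ r → Dec (cls r ≡ r)
  rep? r = cls r Fin.≟ r

  class? : ∀ r y → Dec (cls y ≡ r)
  class? r y = cls y Fin.≟ r

  -- The classes suited for recolouring. Asking for a representative makes each class count at most
  -- once.
  Bad : Fin n → Set
  Bad r = cls r ≡ r × (∀ y → cls y ≡ r → Tip y) × # (class? r) ≤ m

  bad? : ∀ r → Dec (Bad r)
  bad? r = rep? r ×-dec (Fin.all? (λ y → class? r y →-dec tip? y) ×-dec (# (class? r) ≤? m))

  tips-in? : ∀ r y → Dec (Tip y × cls y ≡ r)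
  tips-in? r y = tip? y ×-dec class? r y

  -- Let a class have `c` vertices, `t` of them tips. One non-tip gives `m t + m ≤ m c`, and `c > m`
  -- pays for `m + 1` directly; a represented class with neither is bad and is granted `m`.
  class-charge : ∀ r → m * # (tips-in? r) + (m + 1) * χ (rep? r) ≤ (m + 1) * # (class? r) + m * χ (bad? r)
  class-charge r = go (rep? r) (bad? r)
    where
    open ≤-Reasoning
    t = # (tips-in? r)
    c = # (class? r)
    t≤c : t ≤ c
    t≤c = #-mono (tips-in? r) (class? r) (λ _ → proj₂)
    distrib : ∀ x → m * x + x ≡ (m + 1) * x
    distrib x = trans (cong (m * x +_) (sym (*-identityˡ x))) (sym (*-distribʳ-+ x m 1))
    mt+c≤ : m * t + c ≤ (m + 1) * c
    mt+c≤ = ≤-trans (+-monoˡ-≤ c (*-monoʳ-≤ m t≤c)) (≤-reflexive (distrib c))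
    go : (ρ : Dec (cls r ≡ r)) (b : Dec (Bad r)) → m * t + (m + 1) * χ ρ ≤ (m + 1) * c + m * χ b
    go (no _) b = begin
      m * t + (m + 1) * 0      ≡⟨ cong (m * t +_) (*-zeroʳ (m + 1)) ⟩
      m * t + 0                ≤⟨ +-monoʳ-≤ (m * t) z≤n ⟩
      m * t + c                ≤⟨ mt+c≤ ⟩
      (m + 1) * c              ≤⟨ m≤m+n _ _ ⟩
      (m + 1) * c + m * χ b    ∎
    go (yes p) (yes b) = begin
      m * t + (m + 1) * 1      ≡⟨ cong (m * t +_) (trans (*-identityʳ (m + 1)) (+-comm m 1)) ⟩
      m * t + (1 + m)          ≡⟨ +-assoc (m * t) 1 m ⟨
      m * t + 1 + m            ≤⟨ +-monoˡ-≤ m (+-monoʳ-≤ (m * t) (#-pos (class? r) r p)) ⟩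
      m * t + c + m            ≤⟨ +-mono-≤ mt+c≤ (≤-reflexive (sym (*-identityʳ m))) ⟩
      (m + 1) * c + m * 1      ∎
    go (yes p) (no ¬b) with Fin.any? (λ y → class? r y ×-dec ¬? (tip? y))
    ... | yes (y , y∈ , ¬tip) = begin
      m * t + (m + 1) * 1      ≡⟨ cong (m * t +_) (*-identityʳ (m + 1)) ⟩
      m * t + (m + 1)          ≡⟨ +-assoc (m * t) m 1 ⟨
      m * t + m + 1            ≡⟨ cong (_+ 1) (trans (+-comm (m * t) m) (sym (*-suc m t))) ⟩
      m * suc t + 1            ≤⟨ +-mono-≤ (*-monoʳ-≤ m t<c) (≤-trans (s≤s z≤n) t<c) ⟩
      m * c + c                ≡⟨ distrib c ⟩
      (m + 1) * c              ≤⟨ m≤m+n _ _ ⟩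
      (m + 1) * c + m * 0      ∎
      where
      t<c : t < c
      t<c = #-mono-< (tips-in? r) (class? r) (λ _ → proj₂) y (¬tip ∘ proj₁) y∈
    ... | no all = begin
      m * t + (m + 1) * 1      ≡⟨ cong (m * t +_) (trans (*-identityʳ (m + 1)) (+-comm m 1)) ⟩
      m * t + suc m            ≤⟨ +-monoʳ-≤ (m * t) (≰⇒> λ c≤m → ¬b (p , tips , c≤m)) ⟩
      m * t + c                ≤⟨ mt+c≤ ⟩
      (m + 1) * c              ≤⟨ m≤m+n _ _ ⟩
      (m + 1) * c + m * 0      ∎
      where
      tips : ∀ y → cls y ≡ r → Tip y
      tips y y∈ = decidable-stable (tip? y) λ ¬tip → all (y , y∈ , ¬tip)

  -- Sum over all classes. Vertices and representatives cancel up to the number of links, which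
  -- leaves `m + 1` per link and `m` per bad class.
  few-tips : m * # tip? ≤ (m + 1) * # link? + m * # bad?
  few-tips = +-cancelʳ-≤ ((m + 1) * # rep?) _ _ (begin
    m * # tip? + (m + 1) * # rep?
      ≡⟨ cong₂ (λ x y → m * x + (m + 1) * y) (sym (#-fibres tip? cls)) (#≡sumF rep?) ⟩
    m * sumF (λ r → # (tips-in? r)) + (m + 1) * sumF (λ r → χ (rep? r))
      ≡⟨ linear m (m + 1) (λ r → # (tips-in? r)) (λ r → χ (rep? r)) ⟨
    sumF (λ r → m * # (tips-in? r) + (m + 1) * χ (rep? r))
      ≤⟨ sumF-mono class-charge ⟩
    sumF (λ r → (m + 1) * # (class? r) + m * χ (bad? r))
      ≡⟨ linear (m + 1) m (λ r → # (class? r)) (λ r → χ (bad? r)) ⟩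
    (m + 1) * sumF (λ r → # (class? r)) + m * sumF (λ r → χ (bad? r))
      ≡⟨ cong₂ (λ x y → (m + 1) * x + m * y) Σclass (sym (#≡sumF bad?)) ⟩
    (m + 1) * n + m * # bad?
      ≤⟨ +-monoˡ-≤ (m * # bad?) (*-monoʳ-≤ (m + 1) (proj₂ (proj₂ classes))) ⟩
    (m + 1) * (# rep? + # link?) + m * # bad?
      ≡⟨ rearrange (m + 1) (# rep?) (# link?) (m * # bad?) ⟩
    (m + 1) * # link? + m * # bad? + (m + 1) * # rep? ∎)
    where
    open ≤-Reasoning
    linear : ∀ a b (f g : Fin n → ℕ) → sumF (λ r → a * f r + b * g r) ≡ a * sumF f + b * sumF g
    linear a b f g = trans (sumF-+ (λ r → a * f r) (λ r → b * g r)) (cong₂ _+_ (sumF-* a f) (sumF-* b g))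
    abstract
      rearrange : ∀ a r l x → a * (r + l) + x ≡ a * l + x + a * r
      rearrange = solve-∀
    Σclass : sumF (λ r → # (class? r)) ≡ n
    Σclass = trans (#-fibres {P = λ _ → ⊤} (λ _ → yes tt) cls) (#-all {P = λ _ → ⊤} (λ _ → yes tt) λ _ → tt)

  β : Fin n → Fin n
  β x with Fin.any? (bigs? x)
  ... | yes (b , _) = b
  -- A default value; tips do have a big neighbour.
  ... | no _        = x

  β-tip : ∀ {x} → Tip x → Adj G x (β x) × Big (β x)
  β-tip {x} (_ , j≡1 , _) with Fin.any? (bigs? x)
  ... | yes (b , p) = p
  ... | no ¬p = ⊥-elim (¬p (#-witness (bigs? x) (≤-reflexive (sym j≡1))))

  tip-big : ∀ {x b} → Tip x → Adj G x b → Big b → b ≡ β x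
  tip-big {x} {b} t a big = #≤1-unique (bigs? x) (≤-reflexive (proj₁ (proj₂ t))) b (β x) (a , big) (β-tip t)

  -- Links and big vertices are disjoint and fill up the degree of a tip, so a neighbour of a third
  -- kind would be one too many.
  tip-neighbour : ∀ {x w} → Tip x → Adj G x w → w ≡ β x ⊎ Link w
  tip-neighbour {x} {w} t@(_ , j≡1 , e≡) a with link? w | big? w
  ... | yes l | _     = inj₂ l
  ... | no _  | yes b = inj₁ (tip-big t a b)
  ... | no ¬l | no ¬b = contradiction (≤-trans (s≤s (≤-trans (≤-reflexive (cong (e x +_) (sym j≡1))) e+j≤)) (#-remove (adj? G x) w a))
                          (<⇒≱ (≤-reflexive (cong suc (sym e≡))))
    where
    e+j≤ : e x + j x ≤ # (others? (adj? G x) w)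
    e+j≤ = #-disjoint (links? x) (bigs? x) (others? (adj? G x) w)
      (λ { v (av , lv) → av , λ { refl → ¬l lv } }) (λ { v (av , bv) → av , λ { refl → ¬b bv } })
      λ v p q → proj₁ (link-lonely (proj₂ p)) (proj₂ q)

  open Assignment cls β m public

  -- Heads of bad classes are tips, so a balanced assignment would put all bad classes at big
  -- vertices, at most `m` at each. There are more bad classes than that.
  saturated : Sparse m G → (∀ u → d u ≢ 1) → (∀ {u v} → Lonely u → Link v → ¬ Adj G u v) → ∃ Nonisolated →
    Saturated Bad
  saturated sparse no-leaf no-lonely-link edge with assign bad?
  ... | inj₂ sat = sat
  ... | inj₁ (balanced head head∈ bounded) = contradiction few (<⇒≱ many)
    where
    open ≤-Reasoning
    many : m * # big? < # bad?
    many = *-cancelˡ-< m _ _ (+-cancelʳ-< ((m + 1) * # link?) _ _ (begin-strict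
      m * (m * # big?) + (m + 1) * # link?  <⟨ Counting.many-tips sparse no-leaf no-lonely-link edge ⟩
      m * # tip?                            ≤⟨ few-tips ⟩
      (m + 1) * # link? + m * # bad?        ≡⟨ +-comm ((m + 1) * # link?) (m * # bad?) ⟩
      m * # bad? + (m + 1) * # link?        ∎))
    pt : ∀ b → # (load? bad? head b) ≤ m * χ (big? b)
    pt b with big? b
    ... | yes p = ≤-trans (bounded b) (≤-reflexive (trans (sym (*-identityʳ m)) (cong (m *_) (sym (χ-yes (big? b) p)))))
    ... | no ¬p = ≤-trans (≤-reflexive (#-none (load? bad? head b) none)) z≤n
      where
      none : ∀ r → ¬ (Bad r × β (head r) ≡ b)
      none r (bad@(_ , tips , _) , e) = ¬p (subst Big e (proj₂ (β-tip (tips (head r) (head∈ bad)))))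
    few : # bad? ≤ m * # big?
    few = begin
      # bad?                                ≡⟨ #-fibres bad? (β ∘ head) ⟨
      sumF (λ b → # (load? bad? head b))    ≤⟨ sumF-mono pt ⟩
      sumF (λ b → m * χ (big? b))           ≡⟨ sumF-* m (λ b → χ (big? b)) ⟩
      m * sumF (λ b → χ (big? b))           ≡⟨ cong (m *_) (#≡sumF big?) ⟨
      m * # big?                            ∎

-- Reductions

module _ {n} (G : Graph n) {D : Fin n → Fin n → Set} (D? : ∀ u v → Dec (D u v)) (D-sym : ∀ {u v} → D u v → D v u) where

  private
    H : Graph n
    H = deleteEdges G D? D-sym

  degree-delete : ∀ u → degree H u ≤ degree G u
  degree-delete u = #-mono (adj? H u) (adj? G u) λ v → deleted⊆ G D? D-sym

  degree-sum-delete : ∀ {u v} → Adj G u v → D u v → sumF (degree H) < sumF (degree G)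
  degree-sum-delete {u} {v} a δ = sumF-mono-< degree-delete u
    (#-mono-< (adj? H u) (adj? G u) (λ w → deleted⊆ G D? D-sym) v (gone G D? D-sym δ) a)

  sparse-delete : ∀ m → Sparse m G → Sparse m H
  sparse-delete m sparse S pos = ≤-trans (s≤s (+-monoˡ-≤ (count S) (*-monoʳ-≤ m (sumF-mono λ u →
    #-mono (λ v → T? (S u ∧ (S v ∧ adj H u v))) (λ v → T? (S u ∧ (S v ∧ adj G u v))) λ v → keep u v)))) (sparse S pos)
    where
    keep : ∀ u v → T (S u ∧ (S v ∧ adj H u v)) → T (S u ∧ (S v ∧ adj G u v))
    keep u v t with S u | S v
    ... | true | true = deleted⊆ G D? D-sym {u} {v} t

-- A linear order with the elements of `P` last: the summand `n` lifts them above every `toℕ`.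
rank : ∀ {n} {P : Fin n → Set} → (∀ x → Dec (P x)) → Fin n → ℕ
rank {n} P? x = n * χ (P? x) + toℕ x

module _ {n} {P : Fin n → Set} (P? : ∀ x → Dec (P x)) where

  rank-no : ∀ {x} → ¬ P x → rank P? x ≡ toℕ x
  rank-no {x} ¬p = cong (_+ toℕ x) (trans (cong (n *_) (χ-no (P? x) ¬p)) (*-zeroʳ n))

  rank-yes : ∀ {x} → P x → rank P? x ≡ n + toℕ x
  rank-yes {x} p = cong (_+ toℕ x) (trans (cong (n *_) (χ-yes (P? x) p)) (*-identityʳ n))

  rank-< : ∀ {x y} → ¬ P x → P y → rank P? x < rank P? y
  rank-< {x} {y} ¬p q rewrite rank-no ¬p | rank-yes q = ≤-trans (Fin.toℕ<n x) (m≤m+n n _)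

  rank-injective : ∀ x y → rank P? x ≡ rank P? y → x ≡ y
  rank-injective x y e = Fin.toℕ-injective (go (P? x) (P? y))
    where
    go : Dec (P x) → Dec (P y) → toℕ x ≡ toℕ y
    go (yes p) (yes q) = +-cancelˡ-≡ n _ _ (trans (sym (rank-yes p)) (trans e (rank-yes q)))
    go (no ¬p) (no ¬q) = trans (sym (rank-no ¬p)) (trans e (rank-no ¬q))
    go (no ¬p) (yes q) = contradiction e (<⇒≢ (rank-< ¬p q))
    go (yes p) (no ¬q) = contradiction (sym e) (<⇒≢ (rank-< ¬q p))

module Choosability (m q : ℕ) (2m≡q+1 : 2 * m ≡ q + 1) (1≤m : 1 ≤ m) (k : ℕ)
  (k-large : 2 * m * (m + 3) * (2 * m * (m + 3)) ≤ k) where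

  Choosable : ∀ {n} → Graph n → Set
  Choosable {n} G = (L : Fin n → List ℕ) → (∀ v → Unique (L v) × k < length (L v)) → Colouring G L

  edgeless : ∀ {n} (G : Graph n) → ¬ (∃ λ u → 0 < degree G u) → Choosable G
  edgeless G none L L-ok = (λ v → proj₁ (pick v)) , (λ v → proj₂ (pick v)) , λ u v _ d _ → none (u , edge d)
    where
    pick = λ v → nonempty-∈ (L v) (≤-trans (s≤s z≤n) (proj₂ (L-ok v)))
    edge : ∀ {u v} → Dist≤2 G u v → 0 < degree G u
    edge {u} {v} (inj₁ a) = #-pos (adj? G u) v a
    edge {u} (inj₂ (w , a , _)) = #-pos (adj? G u) w a

  module _ {n} (G : Graph n) (Δ≤k : ∀ u → degree G u ≤ k) where
    open Clusters G m q 2m≡q+1 1≤m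

    Free : Fin n → Set
    Free v = # (conf? G v) ≤ k

    -- The conflicts of a leaf are its neighbour `x` and the other neighbours of `x`.
    leaf-free : ∀ {v x} → d v ≡ 1 → Adj G v x → Free v
    leaf-free {v} {x} d≡1 a = begin
      # (conf? G v)                                ≤⟨ #-cover (x Fin.≟_) (others? (adj? G x) v) (conf? G v) cover ⟩
      # (x Fin.≟_) + # (others? (adj? G x) v)      ≡⟨ cong (_+ # (others? (adj? G x) v)) (#-≡ x) ⟩
      suc (# (others? (adj? G x) v))               ≤⟨ #-remove (adj? G x) v (Adj-sym G a) ⟩
      d x                                          ≤⟨ Δ≤k x ⟩
      k ∎
      where
      open ≤-Reasoning
      only : ∀ w → Adj G v w → x ≡ w
      only w b = #≤1-unique (adj? G v) (≤-reflexive d≡1) x w a b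
      cover : ∀ u → Conf G v u → x ≡ u ⊎ (Adj G x u × v ≢ u)
      cover u (ne , inj₁ b) = inj₁ (only u b)
      cover u (ne , inj₂ (w , b , c)) with only w b
      ... | refl = inj₂ (c , ne)

    -- Each conflict passes through one of at most `M` neighbours `w`, and `w` together with its own
    -- neighbours amounts to at most `M` vertices because `w` is small.
    lonely-free : ∀ {v} → Lonely v → Free v
    lonely-free {v} (¬big , j≡0) = begin
      # (conf? G v)                            ≤⟨ #-mono (conf? G v) (λ u → Fin.any? λ w → via? w u) (λ u → via u) ⟩
      # (λ u → Fin.any? λ w → via? w u)        ≤⟨ #-∃ via? ⟩
      sumF (λ w → # (via? w))                  ≤⟨ sumF-mono pt ⟩
      sumF (λ w → M * χ (adj? G v w))          ≡⟨ sumF-* M (λ w → χ (adj? G v w)) ⟩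
      M * sumF (λ w → χ (adj? G v w))          ≡⟨ cong (M *_) (#≡sumF (adj? G v)) ⟨
      M * d v                                  ≤⟨ *-monoʳ-≤ M (≰⇒≥ ¬big) ⟩
      M * M                                    ≤⟨ k-large ⟩
      k ∎
      where
      open ≤-Reasoning
      via? : ∀ w u → Dec (Adj G v w × (w ≡ u ⊎ Adj G w u))
      via? w u = adj? G v w ×-dec ((w Fin.≟ u) ⊎-dec adj? G w u)
      via : ∀ u → Conf G v u → ∃ λ w → Adj G v w × (w ≡ u ⊎ Adj G w u)
      via u (_ , inj₁ a) = u , a , inj₁ refl
      via u (_ , inj₂ (w , a , b)) = w , a , inj₂ b
      pt : ∀ w → # (via? w) ≤ M * χ (adj? G v w)
      pt w with adj? G v w
      ... | no ¬a = ≤-trans (≤-reflexive (#-none (via? w) λ u → ¬a ∘ proj₁)) z≤n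
      ... | yes a = begin
        # (via? w)                     ≤⟨ #-cover (w Fin.≟_) (adj? G w) (via? w) (λ _ → proj₂) ⟩
        # (w Fin.≟_) + d w             ≡⟨ cong (_+ d w) (#-≡ w) ⟩
        suc (d w)                      ≤⟨ ≰⇒> (no-big j≡0 a) ⟩
        M                              ≡⟨ *-identityʳ M ⟨
        M * 1                          ≡⟨ cong (M *_) (χ-yes (adj? G v w) a) ⟨
        M * χ (adj? G v w)             ∎

    Pair : Fin n → Fin n → Fin n → Fin n → Set
    Pair a b u v = (u ≡ a × v ≡ b) ⊎ (u ≡ b × v ≡ a)

    pair? : ∀ a b u v → Dec (Pair a b u v)
    pair? a b u v = ((u Fin.≟ a) ×-dec (v Fin.≟ b)) ⊎-dec ((u Fin.≟ b) ×-dec (v Fin.≟ a))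

    pair-sym : ∀ a b {u v} → Pair a b u v → Pair a b v u
    pair-sym a b (inj₁ (p , q)) = inj₂ (q , p)
    pair-sym a b (inj₂ (p , q)) = inj₁ (q , p)

    -- A leaf is not the middle of a path between distinct vertices, so removing its edge disturbs
    -- only the leaf, which is coloured last.
    reduce-leaf : ∀ {v x} → d v ≡ 1 → Adj G v x →
      Choosable (deleteEdges G (pair? v x) (pair-sym v x)) → Choosable G
    reduce-leaf {v} {x} d≡1 a colour L L-ok =
      extend-free (# (λ u → ¬? (W? u))) W? ≤-refl free (proj₁ (colour L L-ok))
        (Dist≤2-colour {deleteEdges G (pair? v x) (pair-sym v x)} {W} (Dist≤2-kept G (pair? v x) (pair-sym v x) W h₁ h₂) (colour L L-ok))
      where
      open Extension G k L L-ok hiding (Free)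
      W : Fin n → Set
      W u = v ≢ u
      W? : ∀ u → Dec (W u)
      W? u = ¬? (v Fin.≟ u)
      free : ∀ u → ¬ W u → Free u
      free u ¬w with decidable-stable (v Fin.≟ u) ¬w
      ... | refl = leaf-free d≡1 a
      h₁ : ∀ {u w} → W u → W w → ¬ Pair v x u w
      h₁ wu ww (inj₁ (refl , _)) = wu refl
      h₁ wu ww (inj₂ (_ , refl)) = ww refl
      h₂ : ∀ {u w y} → W u → W w → u ≢ w → Adj G u y → Adj G y w → ¬ Pair v x u y
      h₂ wu ww ne p q (inj₁ (refl , _)) = wu refl
      h₂ wu ww ne p q (inj₂ (refl , refl)) = ne (#≤1-unique (adj? G v) (≤-reflexive d≡1) _ _ a q)

    -- Both ends of the deleted edge are uncoloured; being lonely, they can be coloured last.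
    reduce-lonely : ∀ {u v} → Lonely u → Lonely v →
      Choosable (deleteEdges G (pair? u v) (pair-sym u v)) → Choosable G
    reduce-lonely {u} {v} lu lv colour L L-ok =
      extend-free (# (λ w → ¬? (W? w))) W? ≤-refl free (proj₁ (colour L L-ok))
        (Dist≤2-colour {deleteEdges G (pair? u v) (pair-sym u v)} {W} (Dist≤2-kept G (pair? u v) (pair-sym u v) W
          (λ ww _ → h ww) (λ ww _ _ _ _ → h ww)) (colour L L-ok))
      where
      open Extension G k L L-ok hiding (Free)
      W : Fin n → Set
      W w = u ≢ w × v ≢ w
      W? : ∀ w → Dec (W w)
      W? w = ¬? (u Fin.≟ w) ×-dec ¬? (v Fin.≟ w)
      free : ∀ w → ¬ W w → Free w
      free w ¬w with u Fin.≟ w | v Fin.≟ w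
      ... | yes refl | _        = lonely-free lu
      ... | no _     | yes refl = lonely-free lv
      ... | no p     | no q     = contradiction (p , q) ¬w
      h : ∀ {w y} → W w → ¬ Pair u v w y
      h ww (inj₁ (refl , _)) = proj₁ ww refl
      h ww (inj₂ (refl , _)) = proj₂ ww refl

    module _ (sat : Saturated Bad) where
      open Saturated sat

      X : Fin n → Set
      X x = R (cls x)

      X? : ∀ x → Dec (X x)
      X? x = R? (cls x)

      X-tip : ∀ {x} → X x → Tip x
      X-tip {x} px = proj₁ (proj₂ (R⊆I px)) x refl

      F : Fin n → Set
      F v = Link v × ∃ λ x → Adj G v x × X x

      F? : ∀ v → Dec (F v)
      F? v = link? v ×-dec Fin.any? λ x → adj? G v x ×-dec X? x

      F-neighbour : ∀ {v u} → F v → Adj G v u → X u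
      F-neighbour (l , x , a , px) b = subst R (cls-link l a b) px

      Cut : Fin n → Fin n → Set
      Cut u v = F u ⊎ F v

      cut? : ∀ u v → Dec (Cut u v)
      cut? u v = F? u ⊎-dec F? v

      cut-sym : ∀ {u v} → Cut u v → Cut v u
      cut-sym = [ inj₂ , inj₁ ]′

      -- Ensures that the induction progresses: a tip without link neighbours would be a leaf.
      cut-edge : (∀ u → d u ≢ 1) → ∃ λ u → ∃ λ v → Adj G u v × Cut u v
      cut-edge no-leaf = r , w , a , inj₂ (l , r , Adj-sym G a , px)
        where
        r = proj₁ some
        px : X r
        px = subst R (sym (proj₁ (R⊆I (proj₂ some)))) (proj₂ some)
        links : ∃ λ w → Adj G r w × Link w
        links = #-witness (links? r) (n≢0⇒n>0 λ e≡0 →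
          no-leaf r (trans (sym (proj₂ (proj₂ (X-tip px)))) (cong (_+ 1) e≡0)))
        w = proj₁ links
        a = proj₁ (proj₂ links)
        l = proj₂ (proj₂ links)

      -- Neighbours of a tip are its big vertex or links, so two tips are never adjacent. A common
      -- neighbour gives the same `β` if it is big and the same class if it is a link.
      X-meet : ∀ x y → X x → X y → Conf G x y → β x ≡ β y ⊎ cls x ≡ cls y
      X-meet x y px py (_ , inj₁ a) with tip-neighbour (X-tip px) a
      ... | inj₁ refl = ⊥-elim (proj₁ (X-tip py) (proj₂ (β-tip (X-tip px))))
      ... | inj₂ l = contradiction (trans (sym (proj₂ l)) (proj₁ (proj₂ (X-tip py)))) λ ()
      X-meet x y px py (_ , inj₂ (w , a , b)) with tip-neighbour (X-tip px) a
      ... | inj₁ refl = inj₁ (tip-big (X-tip py) (Adj-sym G b) (proj₂ (β-tip (X-tip px))))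
      ... | inj₂ l = inj₂ (cls-link l (Adj-sym G a) b)

      Head : Fin n → Set
      Head x = A (cls x) × head (cls x) ≡ x

      head? : ∀ x → Dec (Head x)
      head? x = A? (cls x) ×-dec (head (cls x) Fin.≟ x)

      other? : ∀ x → Dec (¬ Head x)
      other? x = ¬? (head? x)

      -- Heads come last around their big vertex and first in their class.
      open ListColouring β cls (rank head?) (rank other?) (rank-injective head?) (rank-injective other?)

      at? : ∀ b y → Dec (X y × β y ≡ b)
      at? b y = X? y ×-dec (β y Fin.≟ b)

      -- Nothing precedes a head in its class. Fewer than `m` vertices precede a non-head in its
      -- class, and at least `m` heads follow it around its big vertex, which compensates.
      earlier<at : ∀ x → X x → earlier X? x < # (at? (β x))
      earlier<at x px with head? x
      ... | yes hx = begin-strict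
        e₁ + e₂         ≡⟨ cong (e₁ +_) (#-none e₂? none) ⟩
        e₁ + 0          ≡⟨ +-identityʳ e₁ ⟩
        e₁              <⟨ #-mono-< e₁? (at? (β x)) (λ { y (py , b , _) → py , b }) x (λ p → <-irrefl refl (proj₂ (proj₂ p))) (px , refl) ⟩
        # (at? (β x))   ∎
        where
        open ≤-Reasoning
        e₁? = λ y → X? y ×-dec (y ≺₁? x)
        e₂? = λ y → X? y ×-dec (y ≺₂? x)
        e₁ = # e₁?
        e₂ = # e₂?
        none : ∀ y → ¬ (X y × y ≺₂ x)
        none y (py , c , lt) with head? y
        ... | yes hy = <-irrefl (cong (rank other?) (trans (sym (proj₂ hy)) (trans (cong head c) (proj₂ hx)))) lt
        ... | no ¬hy = <-asym lt (rank-< other? (λ ¬hx → ¬hx hx) ¬hy)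
      ... | no ¬hx = begin-strict
        e₁ + e₂                                  <⟨ +-monoʳ-< e₁ e₂<class ⟩
        e₁ + # (class? (cls x))                  ≤⟨ +-monoʳ-≤ e₁ (proj₂ (proj₂ (R⊆I px))) ⟩
        e₁ + m                                   ≤⟨ +-monoʳ-≤ e₁ many-heads ⟩
        e₁ + # heads?                            ≤⟨ #-disjoint e₁? heads? (others? (at? (β x)) x) sub₁ sub₂ disjoint ⟩
        # (others? (at? (β x)) x)                ≤⟨ n≤1+n _ ⟩
        suc (# (others? (at? (β x)) x))          ≤⟨ #-remove (at? (β x)) x (px , refl) ⟩
        # (at? (β x))                            ∎
        where
        open ≤-Reasoning
        e₁? = λ y → X? y ×-dec (y ≺₁? x)
        e₂? = λ y → X? y ×-dec (y ≺₂? x)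
        e₁ = # e₁?
        e₂ = # e₂?
        heads? = λ y → (head? y ×-dec X? y) ×-dec (β y Fin.≟ β x)
        e₂<class : e₂ < # (class? (cls x))
        e₂<class = #-mono-< e₂? (class? (cls x)) (λ _ p → proj₁ (proj₂ p)) x (λ p → <-irrefl refl (proj₂ (proj₂ p))) refl
        many-heads : m ≤ # heads?
        many-heads = ≤-trans (full x px) (#-injection (λ r → (A? r ×-dec R? r) ×-dec (β (head r) Fin.≟ β x)) heads? head
          (λ { r ((ar , pr) , b) → ((subst A (sym (head∈ ar)) ar , cong head (head∈ ar)) , subst R (sym (head∈ ar)) pr) , b })
          (λ { r s ((ar , _) , _) ((as , _) , _) h → trans (sym (head∈ ar)) (trans (cong cls h) (head∈ as)) }))
        sub₁ : ∀ y → X y × y ≺₁ x → (X y × β y ≡ β x) × x ≢ y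
        sub₁ y (py , b , lt) = (py , b) , λ { refl → <-irrefl refl lt }
        sub₂ : ∀ y → (Head y × X y) × β y ≡ β x → (X y × β y ≡ β x) × x ≢ y
        sub₂ y ((hy , py) , b) = (py , b) , λ { refl → ¬hx hy }
        disjoint : ∀ y → X y × y ≺₁ x → (Head y × X y) × β y ≡ β x → ⊥
        disjoint y (_ , _ , lt) ((hy , _) , _) = <-asym lt (rank-< head? ¬hx hy)

      W : Fin n → Set
      W u = ¬ X u × ¬ F u

      W? : ∀ u → Dec (W u)
      W? u = ¬? (X? u) ×-dec ¬? (F? u)

      -- The coloured conflicts of `x` are `β x` and neighbours of `β x` outside `X`, as all link
      -- neighbours of `x` lie in `F`. The strict inequality of `earlier<at` makes up for `β x`
      -- itself.
      room : ∀ x → X x → # (λ u → W? u ×-dec conf? G x u) + earlier X? x ≤ k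
      room x px = begin
        # (λ u → W? u ×-dec conf? G x u) + earlier X? x
          ≤⟨ +-monoˡ-≤ _ (#-cover (β x Fin.≟_) out? (λ u → W? u ×-dec conf? G x u) cover) ⟩
        # (β x Fin.≟_) + # out? + earlier X? x
          ≡⟨ cong (λ i → i + # out? + earlier X? x) (#-≡ (β x)) ⟩
        suc (# out?) + earlier X? x
          ≡⟨ +-suc (# out?) (earlier X? x) ⟨
        # out? + suc (earlier X? x)
          ≤⟨ +-monoʳ-≤ (# out?) (earlier<at x px) ⟩
        # out? + # (at? (β x))
          ≤⟨ #-disjoint out? (at? (β x)) (adj? G (β x)) (λ _ → proj₁)
               (λ { y (py , b) → subst (λ b → Adj G b y) b (Adj-sym G (proj₁ (β-tip (X-tip py)))) })
               (λ _ p r → proj₂ p (proj₁ r)) ⟩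
        d (β x)
          ≤⟨ Δ≤k (β x) ⟩
        k ∎
        where
        open ≤-Reasoning
        out? : ∀ u → Dec (Adj G (β x) u × ¬ X u)
        out? u = adj? G (β x) u ×-dec ¬? (X? u)
        cover : ∀ u → W u × Conf G x u → β x ≡ u ⊎ (Adj G (β x) u × ¬ X u)
        cover u ((¬x , ¬f) , _ , inj₁ a) with tip-neighbour (X-tip px) a
        ... | inj₁ e = inj₁ (sym e)
        ... | inj₂ l = contradiction (l , x , Adj-sym G a , px) ¬f
        cover u ((¬x , ¬f) , _ , inj₂ (w , a , b)) with tip-neighbour (X-tip px) a
        ... | inj₁ refl = inj₂ (b , ¬x)
        ... | inj₂ l = contradiction (F-neighbour (l , x , Adj-sym G a , px) b) ¬x

      -- First `W` is coloured by the smaller graph, then the tips `X` by the kernel method, and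
      -- last the links `F`, which are lonely and hence free.
      reduce-saturated : Choosable (deleteEdges G cut? cut-sym) → Choosable G
      reduce-saturated colour L L-ok =
        extend-free _ W∪X? ≤-refl free (proj₁ extended) (proj₂ extended)
        where
        open Extension G k L L-ok hiding (Free)
        h₂ : ∀ {u v w} → W u → W v → u ≢ v → Adj G u w → Adj G w v → ¬ Cut u w
        h₂ wu wv _ a _ (inj₁ f) = proj₂ wu f
        h₂ wu wv _ a _ (inj₂ f) = proj₁ wu (F-neighbour f (Adj-sym G a))
        extended = extend-galvin β cls (rank head?) (rank other?) (rank-injective head?) (rank-injective other?)
          W? X? X-meet room (proj₁ (colour L L-ok))
          (Dist≤2-colour {deleteEdges G cut? cut-sym} {W}
            (Dist≤2-kept G cut? cut-sym W (λ wu wv → [ proj₂ wu , proj₂ wv ]′) h₂) (colour L L-ok))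
        W∪X? : ∀ u → Dec (W u ⊎ X u)
        W∪X? u = W? u ⊎-dec X? u
        free : ∀ u → ¬ (W u ⊎ X u) → Free u
        free u ¬p with F? u
        ... | yes f = lonely-free (link-lonely (proj₁ f))
        ... | no ¬f = contradiction (inj₁ (¬p ∘ inj₂ , ¬f)) ¬p

  -- Induction on the degree sum. `k` stays fixed, so the degree bound and sparsity pass to every
  -- graph with edges deleted.
  choosable : ∀ fuel {n} (G : Graph n) → sumF (degree G) < fuel → (∀ u → degree G u ≤ k) → Sparse m G → Choosable G
  choosable (suc fuel) {n} G lt Δ≤k sparse = cases
    where
    open Clusters G m q 2m≡q+1 1≤m

    module _ {D : Fin n → Fin n → Set} (D? : ∀ u v → Dec (D u v)) (D-sym : ∀ {u v} → D u v → D v u) where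
      smaller : ∀ {u v} → Adj G u v → D u v → Choosable (deleteEdges G D? D-sym)
      smaller a δ = choosable fuel (deleteEdges G D? D-sym)
        (≤-trans (degree-sum-delete G D? D-sym a δ) (≤-pred lt))
        (λ u → ≤-trans (degree-delete G D? D-sym u) (Δ≤k u)) (sparse-delete G D? D-sym m sparse)

    cases : Choosable G
    cases with Fin.any? nonisolated?
    ... | no none = edgeless G none
    ... | yes edge with Fin.any? (λ v → d v ≟ 1)
    ...   | yes (v , d≡1) = let x , a = #-witness (adj? G v) (≤-reflexive (sym d≡1)) in
      reduce-leaf G Δ≤k d≡1 a (smaller (pair? G Δ≤k v x) (pair-sym G Δ≤k v x) a (inj₁ (refl , refl)))
    ...   | no no-leaf with Fin.any? (λ u → Fin.any? λ v → (¬? (big? u) ×-dec (j u ≟ 0)) ×-dec (link? v ×-dec adj? G u v))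
    ...     | yes (u , v , lu , lv , a) =
      reduce-lonely G Δ≤k lu (link-lonely lv) (smaller (pair? G Δ≤k u v) (pair-sym G Δ≤k u v) a (inj₁ (refl , refl)))
    ...     | no none =
      let sat = saturated sparse (λ u p → no-leaf (u , p)) (λ lu lv a → none (_ , _ , lu , lv , a)) edge
          u , v , a , δ = cut-edge G Δ≤k sat (λ u p → no-leaf (u , p))
      in reduce-saturated G Δ≤k sat (smaller (cut? G Δ≤k sat) (cut-sym G Δ≤k sat) a δ)

-- The lower bound

≤maxF : ∀ {n} (f : Fin n → ℕ) x → f x ≤ maxF f
≤maxF f zero    = m≤m⊔n _ _
≤maxF f (suc x) = ≤-trans (≤maxF (f ∘ suc) x) (m≤n⊔m (f zero) _)

maxF-attained : ∀ {n} (f : Fin n → ℕ) → 0 < maxF f → ∃ λ x → f x ≡ maxF f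
maxF-attained {suc n} f pos with ⊔-sel (f zero) (maxF (f ∘ suc))
... | inj₁ e = zero , sym e
... | inj₂ e with maxF-attained (f ∘ suc) (subst (0 <_) e pos)
...   | x , e′ = suc x , trans e′ (sym e)

-- Pigeonhole with identical lists of `Δ G` colours: a vertex of maximum degree and its neighbours
-- are `Δ G + 1` vertices pairwise at distance at most two.
not-Δ-choosable : ∀ {n} (G : Graph n) → 0 < Δ G → ¬ Square-choosable G (Δ G)
not-Δ-choosable {n} G pos colour with maxF-attained (degree G) pos
... | v , dv≡Δ with colour (λ _ → upTo (Δ G)) (λ _ → Unique.upTo⁺ (Δ G) , ≤-reflexive (sym (length-upTo (Δ G))))
...   | c , c∈ , proper = <-irrefl refl (begin-strict
    Δ G                            ≡⟨ dv≡Δ ⟨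
    degree G v                     <⟨ s≤s (#-mono (adj? G v) (others? star? v) λ u a → inj₂ a , λ { refl → Adj-irrefl G a }) ⟩
    suc (# (others? star? v))      ≤⟨ #-remove star? v (inj₁ refl) ⟩
    # star?                        ≤⟨ #-injection star? any-colour? (λ u → fromℕ< (∈-upTo⁻ (c∈ u))) (λ _ _ → tt) inj ⟩
    # any-colour?                  ≤⟨ #≤n any-colour? ⟩
    Δ G                            ∎)
  where
  open ≤-Reasoning
  star? : ∀ u → Dec (v ≡ u ⊎ Adj G v u)
  star? u = (v Fin.≟ u) ⊎-dec adj? G v u
  any-colour? : (z : Fin (Δ G)) → Dec ⊤
  any-colour? _ = yes tt
  near : ∀ {u w} → u ≢ w → v ≡ u ⊎ Adj G v u → v ≡ w ⊎ Adj G v w → Dist≤2 G u w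
  near ne (inj₁ refl) (inj₁ refl) = contradiction refl ne
  near ne (inj₁ refl) (inj₂ b)    = inj₁ b
  near ne (inj₂ a)    (inj₁ refl) = inj₁ (Adj-sym G a)
  near ne (inj₂ a)    (inj₂ b)    = inj₂ (v , Adj-sym G a , b)
  inj : ∀ u w → v ≡ u ⊎ Adj G v u → v ≡ w ⊎ Adj G v w →
        fromℕ< (∈-upTo⁻ (c∈ u)) ≡ fromℕ< (∈-upTo⁻ (c∈ w)) → u ≡ w
  inj u w a b e = decidable-stable (u Fin.≟ w) λ ne →
    proper u w ne (near ne a b) (Fin.fromℕ<-injective (c u) (c w) (∈-upTo⁻ (c∈ u)) (∈-upTo⁻ (c∈ w)) e)

-- From rational density to integer sparsity, and the conclusion

open import Data.Integer using (+_; +[1+_])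

-- A positive rational with denominator `m` is at least `1/m`. The comparison is moved to
-- unnormalised rationals, where it can be cross-multiplied without reducing fractions.
mad⇒sparse : ∀ {n} (G : Graph n) ε → 0ℚ ℚ.< ε → madLT G (ℕtoℚ 3 ℚ.- ε) → Sparse (↧ₙ ε) G
mad⇒sparse G (mkℚ (+ zero) l _) (ℚ.*<* (ℤ.+<+ ())) mad S pos
mad⇒sparse G ε@(mkℚ +[1+ p ] l _) _ mad S pos = begin-strict
  suc l * t + s                ≡⟨ cong (_+ s) (*-comm (suc l) t) ⟩
  t * suc l + s                ≤⟨ +-monoʳ-≤ (t * suc l) (m≤m+n s (p * s)) ⟩
  t * suc l + suc p * s        <⟨ ℤ.drop‿+<+ integers ⟩
  3 * suc l * s                ∎
  where
  open ≤-Reasoning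
  t = twiceEdges G S
  s = count S
  rationals : mkℚᵘ (+ t) 0 ℚᵘ.< (mkℚᵘ (+ 3) 0 ℚᵘ.- mkℚᵘ +[1+ p ] l) ℚᵘ.* mkℚᵘ (+ s) 0
  rationals = ℚᵘ.<-respˡ-≃ (ℚ.toℚᵘ-fromℚᵘ (mkℚᵘ (+ t) 0)) (ℚᵘ.<-respʳ-≃ right (ℚ.toℚᵘ-mono-< (mad S pos)))
    where
    right : toℚᵘ ((ℕtoℚ 3 ℚ.- ε) ℚ.* ℕtoℚ s) ℚᵘ.≃ (mkℚᵘ (+ 3) 0 ℚᵘ.- mkℚᵘ +[1+ p ] l) ℚᵘ.* mkℚᵘ (+ s) 0
    right = ℚᵘ.≃-trans (ℚ.toℚᵘ-homo-* (ℕtoℚ 3 ℚ.- ε) (ℕtoℚ s))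
      (ℚᵘ.*-cong (ℚᵘ.≃-trans (ℚ.toℚᵘ-homo-+ (ℕtoℚ 3) (ℚ.- ε)) (ℚᵘ.+-congʳ (mkℚᵘ (+ 3) 0) (ℚ.toℚᵘ-homo‿- ε)))
                 (ℚ.toℚᵘ-fromℚᵘ (mkℚᵘ (+ s) 0)))
  expand : ∀ Q P s → (+ 3 ℤ.* Q ℤ.+ (ℤ.- P) ℤ.* + 1) ℤ.* s ℤ.* + 1 ℤ.+ P ℤ.* s ≡ + 3 ℤ.* Q ℤ.* s
  expand = ℤ-Solver.solve-∀
  integers : + (t * suc l + suc p * s) ℤ.< + (3 * suc l * s)
  integers with rationals
  ... | *<* lt = subst₂ ℤ._<_ lhs rhs (ℤ.+-monoˡ-< (+ suc p ℤ.* + s) lt)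
    where
    lhs : _ ≡ + (t * suc l + suc p * s)
    lhs = cong₂ ℤ._+_ (trans (sym (ℤ.pos-* t _)) (cong (λ x → + (t * x)) (trans (*-identityʳ (1 * suc l)) (*-identityˡ (suc l)))))
                      (sym (ℤ.pos-* (suc p) s))
    rhs : _ ≡ + (3 * suc l * s)
    rhs = trans (expand (+ suc l) (+ suc p) (+ s))
            (trans (cong (ℤ._* + s) (sym (ℤ.pos-* 3 (suc l)))) (sym (ℤ.pos-* (3 * suc l) s)))

threshold : ℕ → ℕ
threshold m = 2 * m * (m + 3) * (2 * m * (m + 3))

theorem1 : Σ (ℚ → ℕ) (λ f → ∀ (ε : ℚ) → 0ℚ ℚ.< ε →
    ∀ (n : ℕ) (G : Graph n) → madLT G (ℕtoℚ 3 ℚ.- ε) → f ε ≤ Δ G →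
    χ²ℓ≡ G (suc (Δ G)))
theorem1 = (λ ε → threshold (↧ₙ ε)) , λ ε ε>0 n G mad large →
  -- Here `m` is the denominator of `ε` and the second argument is `q = 2 m - 1`.
  (λ L L-ok → Choosability.choosable (↧ₙ ε) (1 + 2 * ℚ.ℚ.denominator-1 ε) (double (ℚ.ℚ.denominator-1 ε)) (s≤s z≤n) (Δ G) large
     (suc (sumF (degree G))) G ≤-refl (≤maxF (degree G)) (mad⇒sparse G ε ε>0 mad) L L-ok) ,
  not-Δ-choosable G (≤-trans (s≤s z≤n) large)
  where
  double : ∀ l → 2 * suc l ≡ 1 + 2 * l + 1
  double = solve-∀
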